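{- For every integer $n\ge 9$, $t(K(n,3)) =\frac{n}{3}-1$. Moreover, if $S$ is a vertex cut of $K(n,3)$ such that $\frac{|S|}{c(K(n,3)\setminus S)} = \frac{n}{3}-1$, then $S$ is the complement of a maximum independent set of $K(n,3)$.
   Context: The Kneser graph $K(n,k)$ has as vertices the $k$-element subsets of $[n]=\{1,\dots,n\}$, two vertices adjacent iff the subsets are disjoint. A vertex cut is a set $S$ of vertices whose removal disconnects the graph; $c(G\setminus S)$ is the number of connected components after deleting $S$; the toughness is $t(G)=\min_S |S|/c(G\setminus S)$ over all vertex cuts $S$. -}

module Defs where

open import Data.Bool using (Bool; true; false; not; _∧_)
open import Data.Nat using (ℕ; zero; suc; _*_; _≤_; _≡ᵇ_)
open import Data.Fin using (Fin)
open import Data.Vec using ([]; _∷_)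
open import Data.List using (List; []; _∷_; _++_; map; filterᵇ; length)
open import Data.Fin.Subset using (Subset; ∣_∣; _∩_; Empty)
open import Data.Product using (Σ; _×_; ∃; ∃-syntax; _,_)
open import Relation.Nullary using (¬_)
open import Relation.Binary.PropositionalEquality using (_≡_; _≢_)
open import Relation.Binary.Construct.Closure.ReflexiveTransitive using (Star)
open import Function.Bundles using (_⇔_)

allSubsets : (n : ℕ) → List (Subset n)
allSubsets zero = [] ∷ []
allSubsets (suc n) = map (true ∷_) (allSubsets n) ++ map (false ∷_) (allSubsets n)

-- The Kneser graph K(n,k): vertices are the subsets x of Fin n with
-- ∣ x ∣ ≡ k; x and y are adjacent iff x ∩ y is empty.
-- Vertex sets of K(n,k) are Boolean predicates on Subset n
-- (only their values on vertices matter).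

IsVertex : (n k : ℕ) → Subset n → Set
IsVertex n k x = ∣ x ∣ ≡ k

isVertex : (n k : ℕ) → Subset n → Bool
isVertex n k x = ∣ x ∣ ≡ᵇ k

Adj : (n : ℕ) → Subset n → Subset n → Set
Adj n x y = Empty (x ∩ y)

VSet : ℕ → Set
VSet n = Subset n → Bool

card : (n k : ℕ) → VSet n → ℕ
card n k S = length (filterᵇ (λ x → isVertex n k x ∧ S x) (allSubsets n))

Remains : (n k : ℕ) → VSet n → Subset n → Set
Remains n k S x = IsVertex n k x × S x ≡ false

EdgeMinus : (n k : ℕ) → VSet n → Subset n → Subset n → Set
EdgeMinus n k S x y = Remains n k S x × Remains n k S y × Adj n x y

ConnMinus : (n k : ℕ) → VSet n → Subset n → Subset n → Set
ConnMinus n k S = Star (EdgeMinus n k S)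

-- c(K(n,k) ∖ S) = c : the remaining vertices are labelled by Fin c
-- so that every label is used and two remaining vertices get the same
-- label iff they lie in the same connected component.
HasComponents : (n k : ℕ) → VSet n → ℕ → Set
HasComponents n k S c =
  Σ ((x : Subset n) → Remains n k S x → Fin c) λ comp →
    ((x y : Subset n) (rx : Remains n k S x) (ry : Remains n k S y) →
       (comp x rx ≡ comp y ry) ⇔ ConnMinus n k S x y)
    × ((i : Fin c) → ∃[ x ] Σ (Remains n k S x) λ rx → comp x rx ≡ i)

IsCutWith : (n k : ℕ) → VSet n → ℕ → Set
IsCutWith n k S c = HasComponents n k S c × 2 ≤ c

-- |S| / c = num / den   (den > 0, c > 0), by cross-multiplication
RatioEq : (n k : ℕ) → VSet n → ℕ → ℕ → ℕ → Set
RatioEq n k S c num den = den * card n k S ≡ num * c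

ToughnessIs : (n k : ℕ) → ℕ → ℕ → Set
ToughnessIs n k num den =
  ((S : VSet n) (c : ℕ) → IsCutWith n k S c → num * c ≤ den * card n k S)
  × (∃[ S ] ∃[ c ] (IsCutWith n k S c × RatioEq n k S c num den))

Independent : (n k : ℕ) → VSet n → Set
Independent n k I =
  (x y : Subset n) → IsVertex n k x → IsVertex n k y →
  I x ≡ true → I y ≡ true → x ≢ y → ¬ Adj n x y

MaxIndependent : (n k : ℕ) → VSet n → Set
MaxIndependent n k I =
  Independent n k I × ((J : VSet n) → Independent n k J → card n k J ≤ card n k I)

ComplementOfMaxIndep : (n k : ℕ) → VSet n → Set
ComplementOfMaxIndep n k S =
  ∃[ I ] (MaxIndependent n k I × ((x : Subset n) → IsVertex n k x → S x ≡ not (I x)))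

{-# OPTIONS --safe #-}
-- A Hoffman-type bound handles all components at once.  Let M = C(n−1,2) be the size of a star,
-- μ = C(n−4,2) and d = C(n−3,3), so that −μ is the least eigenvalue of K(n,3) and d is its degree.
-- For every weight f on the vertices,
--     μ (Σ f)² ≤ M (Σ_{x disjoint from y} f x · f y + μ Σ f²).
-- Give every vertex of a component of size s the weight (3 (s − 1) + n) / s.  The neighbours of a
-- remaining vertex x that remain lie in its own component, so there are at most s − 1 of them; and
-- for a vertex z of another component the C(n−5,3) or more neighbours of x that are disjoint from z
-- have all been deleted, so there are at most d − C(n−5,3) of them.  For n ≥ 9 these two bounds make
-- the right-hand side at most M n μ Σ f, strictly less if some s exceeds 1.  Hence
--     Σ f = 3 (number of remaining vertices) + (n − 3) c ≤ M n = 3 C(n,3),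
-- which is the toughness bound, and equality forces all components to be single vertices.
module Submission where

open import Defs
open import Algebra.Bundles using (CommutativeSemiring)
import Algebra.Properties.CommutativeSemigroup as CommutativeSemigroupProperties
open import Data.Bool using (Bool; true; false; not; _∧_)
import Data.Bool as Bool
open import Data.Bool.Properties using (T-≡; T?; ∧-zeroʳ; not-involutive; not-injective)
open import Data.Fin using (Fin; zero; suc)
import Data.Fin as Fin
open import Data.Fin.Subset using (Subset; ∣_∣; _∩_; _∪_; ∁; ⁅_⁆; ⊥; _⊆_)
import Data.Fin.Subset as Subset
open import Data.Fin.Subset.Properties
open import Data.List using (List; []; _∷_; _++_; map; filterᵇ; length; allFin)
import Data.List as List
open import Data.List.Membership.Propositional using (_∈_; _∉_)
open import Data.List.Membership.Propositional.Properties
  using (∈-map⁺; ∈-map⁻; ∈-++⁺ˡ; ∈-++⁺ʳ; ∈-filter⁺; ∈-filter⁻; ∈-allFin; ∈-lookup)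
open import Data.List.Membership.Setoid.Properties using (index-injective)
open import Data.List.Properties using (map-tabulate; length-tabulate)
open import Data.List.Relation.Unary.All using ([])
open import Data.List.Relation.Unary.All.Properties using (All¬⇒¬Any)
open import Data.List.Relation.Unary.AllPairs using ([]; _∷_)
open import Data.List.Relation.Unary.Any using (here; there; index)
open import Data.List.Relation.Unary.Unique.Propositional using (Unique)
open import Data.List.Relation.Unary.Unique.Propositional.Properties using (map⁺; ++⁺; filter⁺; allFin⁺)
open import Data.Product using (_×_; _,_; proj₁; proj₂; ∃-syntax)
open import Data.Vec using ([]; _∷_; lookup)
open import Data.Vec.Properties using (∷-injectiveʳ; ≡-dec; lookup-zipWith; lookup⇒[]=)
open import Function using (_∘_; id; it; mk⇔)
open import Function.Bundles using (Equivalence; _⇔_)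
open import Level using (Level)
open import Relation.Binary using (DecidableEquality)
open import Relation.Binary.Construct.Closure.ReflexiveTransitive using (ε; _◅_)
open import Relation.Binary.PropositionalEquality
open import Relation.Nullary using (¬_; Dec; yes; no; contradiction; does)
open import Relation.Nullary.Decidable using (_×-dec_; decidable-stable)

-- The inequality says that A + μ I - (μ/M) J is positive semidefinite, with A the adjacency matrix
-- and J the all-ones matrix. No eigenspaces are built: this form vanishes on the span of the stars,
-- so it is written as an explicit sum of squares of what is left after removing that span. The
-- weights come from working backwards. As 3 C(n,3) = n M, the bound Σ f ≤ M n becomes (n - 3) c ≤ 3
-- |S| once a component of size s has total weight 3 (s - 1) + n. Spread evenly, the weight w is
-- constant along remaining edges, so x contributes w² (deg x + μ) to the form, and w (deg x + μ) ≤
-- n μ suffices. Single vertices have w = n and give equality. For u = s - 1 > 0 the identity (n -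
-- 3) μ = 3 d turns the claim into (3 u + n) deg x < 3 u d: deg x ≤ u settles small u, the bound by
-- d - C(n-5,3) settles large u, and the two ranges meet because n < 3 C(n-5,3), which first holds
-- at n = 9. In the equality case exactly M single vertices remain, and the same inequality for the
-- indicator of an independent set shows that none is larger than M.

-- Finite sums over a commutative semiring, used over both ℕ and ℤ.

module Sums {c ℓ} (R : CommutativeSemiring c ℓ) where
  open CommutativeSemiring R renaming (refl to ≈-refl; sym to ≈-sym; trans to ≈-trans)
  open CommutativeSemigroupProperties +-commutativeSemigroup using (interchange)

  private
    variable
      a b : Level
      A : Set a
      B : Set b

  ind : Bool → Carrier
  ind true  = 1#
  ind false = 0#

  ind-∧ : ∀ a b → ind (a ∧ b) ≈ ind a * ind b
  ind-∧ true  b = ≈-sym (*-identityˡ (ind b))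
  ind-∧ false b = ≈-sym (zeroˡ (ind b))

  ind-idem : ∀ b → ind b * ind b ≈ ind b
  ind-idem true  = *-identityˡ 1#
  ind-idem false = zeroˡ 0#

  ∑ : List A → (A → Carrier) → Carrier
  ∑ []       φ = 0#
  ∑ (x ∷ xs) φ = φ x + ∑ xs φ

  ∑-cong : ∀ (xs : List A) {φ ψ : A → Carrier} → (∀ {x} → x ∈ xs → φ x ≈ ψ x) → ∑ xs φ ≈ ∑ xs ψ
  ∑-cong []       eq = ≈-refl
  ∑-cong (x ∷ xs) eq = +-cong (eq (here refl)) (∑-cong xs (eq ∘ there))

  ∑-0 : ∀ (xs : List A) → ∑ xs (λ _ → 0#) ≈ 0#
  ∑-0 []       = ≈-refl
  ∑-0 (x ∷ xs) = ≈-trans (+-identityˡ _) (∑-0 xs)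

  ∑-+ : ∀ (xs : List A) (φ ψ : A → Carrier) → ∑ xs (λ x → φ x + ψ x) ≈ ∑ xs φ + ∑ xs ψ
  ∑-+ []       φ ψ = ≈-sym (+-identityˡ 0#)
  ∑-+ (x ∷ xs) φ ψ = ≈-trans (+-congˡ (∑-+ xs φ ψ)) (interchange _ _ _ _)

  ∑-*ˡ : ∀ (xs : List A) k (φ : A → Carrier) → ∑ xs (λ x → k * φ x) ≈ k * ∑ xs φ
  ∑-*ˡ []       k φ = ≈-sym (zeroʳ k)
  ∑-*ˡ (x ∷ xs) k φ = ≈-trans (+-congˡ (∑-*ˡ xs k φ)) (≈-sym (distribˡ k _ _))

  ∑-*ʳ : ∀ (xs : List A) k (φ : A → Carrier) → ∑ xs (λ x → φ x * k) ≈ ∑ xs φ * k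
  ∑-*ʳ []       k φ = ≈-sym (zeroˡ k)
  ∑-*ʳ (x ∷ xs) k φ = ≈-trans (+-congˡ (∑-*ʳ xs k φ)) (≈-sym (distribʳ k _ _))

  ∑-comm : ∀ (xs : List A) (ys : List B) (φ : A → B → Carrier) →
           ∑ xs (λ x → ∑ ys (φ x)) ≈ ∑ ys (λ y → ∑ xs (λ x → φ x y))
  ∑-comm []       ys φ = ≈-sym (∑-0 ys)
  ∑-comm (x ∷ xs) ys φ = ≈-trans (+-congˡ (∑-comm xs ys φ)) (≈-sym (∑-+ ys _ _))

  ∑-product : ∀ (xs : List A) (ys : List B) (φ : A → Carrier) (ψ : B → Carrier) →
              ∑ xs (λ x → ∑ ys (λ y → φ x * ψ y)) ≈ ∑ xs φ * ∑ ys ψ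
  ∑-product xs ys φ ψ =
    ≈-trans (∑-cong xs λ {x} _ → ∑-*ˡ ys (φ x) ψ) (∑-*ʳ xs (∑ ys ψ) φ)

  ∑-++ : ∀ (xs ys : List A) (φ : A → Carrier) → ∑ (xs ++ ys) φ ≈ ∑ xs φ + ∑ ys φ
  ∑-++ []       ys φ = ≈-sym (+-identityˡ _)
  ∑-++ (x ∷ xs) ys φ = ≈-trans (+-congˡ (∑-++ xs ys φ)) (≈-sym (+-assoc _ _ _))

  ∑-map : ∀ (g : A → B) xs (φ : B → Carrier) → ∑ (map g xs) φ ≈ ∑ xs (φ ∘ g)
  ∑-map g []       φ = ≈-refl
  ∑-map g (x ∷ xs) φ = +-congˡ (∑-map g xs φ)

  module _ {A : Set a} (_≟_ : DecidableEquality A) where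

    ∑-δ-∉ : ∀ xs {x} (φ : A → Carrier) → x ∉ xs → ∑ xs (λ y → ind (does (x ≟ y)) * φ y) ≈ 0#
    ∑-δ-∉ []       φ x∉ = ≈-refl
    ∑-δ-∉ (z ∷ xs) {x} φ x∉ with x ≟ z
    ... | yes x≡z = contradiction (here x≡z) x∉
    ... | no  _   = ≈-trans (+-cong (zeroˡ _) (∑-δ-∉ xs φ (x∉ ∘ there))) (+-identityˡ 0#)

    ∑-δ : ∀ {xs x} (φ : A → Carrier) → Unique xs → x ∈ xs → ∑ xs (λ y → ind (does (x ≟ y)) * φ y) ≈ φ x
    ∑-δ {z ∷ xs} {x} φ (z∉ ∷ _) (here refl) with z ≟ z
    ... | yes _   = ≈-trans (+-cong (*-identityˡ _) (∑-δ-∉ xs φ (All¬⇒¬Any z∉))) (+-identityʳ _)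
    ... | no  z≢z = contradiction refl z≢z
    ∑-δ {z ∷ xs} {x} φ (z∉ ∷ u) (there x∈) with x ≟ z
    ... | yes refl = contradiction x∈ (All¬⇒¬Any z∉)
    ... | no  _    = ≈-trans (+-cong (zeroˡ _) (∑-δ φ u x∈)) (+-identityˡ _)

-- Counting triples with prescribed points; binomial identities.

module Counting where
  open import Data.Nat
  open import Data.Nat.Combinatorics using (_C_; nCk+nC[k+1]≡[n+1]C[k+1]; nC1≡n)
  open import Data.Nat.Properties
  open import Data.Nat.Tactic.RingSolver using (solve-∀)
  open Sums +-*-commutativeSemiring
  open ≡-Reasoning

  ∑-filter : ∀ {A : Set} P (xs : List A) (φ : A → ℕ) → ∑ (filterᵇ P xs) φ ≡ ∑ xs (λ x → ind (P x) * φ x)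
  ∑-filter P []       φ = refl
  ∑-filter P (x ∷ xs) φ with P x
  ... | true  = cong₂ _+_ (sym (+-identityʳ (φ x))) (∑-filter P xs φ)
  ... | false = ∑-filter P xs φ

  length-filter : ∀ {A : Set} P (xs : List A) → length (filterᵇ P xs) ≡ ∑ xs (ind ∘ P)
  length-filter P []       = refl
  length-filter P (x ∷ xs) with P x
  ... | true  = cong suc (length-filter P xs)
  ... | false = length-filter P xs

  ∑-allSubsets : ∀ {n} (φ : Subset (suc n) → ℕ) →
                 ∑ (allSubsets (suc n)) φ ≡ ∑ (allSubsets n) (φ ∘ (true ∷_)) + ∑ (allSubsets n) (φ ∘ (false ∷_))
  ∑-allSubsets {n} φ = trans (∑-++ (map (true ∷_) (allSubsets n)) _ φ)
    (cong₂ _+_ (∑-map (true ∷_) (allSubsets n) φ) (∑-map (false ∷_) (allSubsets n) φ))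

  ∈-allSubsets : ∀ {n} (x : Subset n) → x ∈ allSubsets n
  ∈-allSubsets []          = here refl
  ∈-allSubsets (true  ∷ x) = ∈-++⁺ˡ (∈-map⁺ (true ∷_) (∈-allSubsets x))
  ∈-allSubsets (false ∷ x) = ∈-++⁺ʳ _ (∈-map⁺ (false ∷_) (∈-allSubsets x))

  allSubsets-unique : ∀ n → Unique (allSubsets n)
  allSubsets-unique zero    = [] ∷ []
  allSubsets-unique (suc n) =
    ++⁺ (map⁺ ∷-injectiveʳ (allSubsets-unique n)) (map⁺ ∷-injectiveʳ (allSubsets-unique n)) disjoint
    where
    disjoint : ∀ {x} → x ∈ map (true ∷_) (allSubsets n) × x ∈ map (false ∷_) (allSubsets n) → _
    disjoint (p , q) with ∈-map⁻ (true ∷_) p | ∈-map⁻ (false ∷_) q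
    ... | _ , _ , refl | _ , _ , ()

  -- Pascal's rule at the first point: a point of `p` must be left out of `y`, any other point may
  -- be in or out. All counts of triples below are derived from this one.
  count-avoiding : ∀ {n} (p : Subset n) k →
                   ∑ (allSubsets n) (λ y → ind (isVertex n k y) * ind (∣ y ∩ p ∣ ≡ᵇ 0)) ≡ ∣ ∁ p ∣ C k
  count-avoiding []      zero    = refl
  count-avoiding []      (suc k) = refl
  count-avoiding {suc n} (true ∷ p) k = begin
    ∑ (allSubsets (suc n)) _  ≡⟨ ∑-allSubsets {n} _ ⟩
    ∑ (allSubsets n) (λ y → φ y * 0) + _
      ≡⟨ cong₂ _+_ (trans (∑-*ʳ (allSubsets n) 0 φ) (*-zeroʳ (∑ (allSubsets n) φ))) (count-avoiding p k) ⟩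
    ∣ ∁ p ∣ C k               ∎
    where
    φ : Subset n → ℕ
    φ y = ind (isVertex (suc n) k (true ∷ y))
  count-avoiding {suc n} (false ∷ p) zero =
    trans (∑-allSubsets {n} _) (cong₂ _+_ (∑-0 (allSubsets n)) (count-avoiding p 0))
  count-avoiding {suc n} (false ∷ p) (suc k) =
    trans (∑-allSubsets {n} _)
    (trans (cong₂ _+_ (count-avoiding p k) (count-avoiding p (suc k))) (nCk+nC[k+1]≡[n+1]C[k+1] ∣ ∁ p ∣ k))

  vertices : ∀ n → List (Subset n)
  vertices n = filterᵇ (isVertex n 3) (allSubsets n)

  vertices-unique : ∀ n → Unique (vertices n)
  vertices-unique n = filter⁺ (T? ∘ isVertex n 3) (allSubsets-unique n)

  ∈-vertices⁺ : ∀ {n} {x : Subset n} → ∣ x ∣ ≡ 3 → x ∈ vertices n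
  ∈-vertices⁺ {n} {x} ∣x∣≡3 = ∈-filter⁺ (T? ∘ isVertex n 3) (∈-allSubsets x) (≡⇒≡ᵇ ∣ x ∣ 3 ∣x∣≡3)

  ∈-vertices⁻ : ∀ {n} {x : Subset n} → x ∈ vertices n → ∣ x ∣ ≡ 3
  ∈-vertices⁻ {n} {x} x∈ = ≡ᵇ⇒≡ ∣ x ∣ 3 (proj₂ (∈-filter⁻ (T? ∘ isVertex n 3) {xs = allSubsets n} x∈))

  card≡∑ : ∀ n S → card n 3 S ≡ ∑ (vertices n) (ind ∘ S)
  card≡∑ n S = begin
    card n 3 S                                                ≡⟨ length-filter _ (allSubsets n) ⟩
    ∑ (allSubsets n) (λ x → ind (isVertex n 3 x ∧ S x))
      ≡⟨ ∑-cong (allSubsets n) (λ {x} _ → ind-∧ (isVertex n 3 x) (S x)) ⟩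
    ∑ (allSubsets n) (λ x → ind (isVertex n 3 x) * ind (S x)) ≡⟨ ∑-filter (isVertex n 3) (allSubsets n) _ ⟨
    ∑ (vertices n) (ind ∘ S)                                  ∎

  disjoint? : ∀ {n} → Subset n → Subset n → Bool
  disjoint? x y = ∣ x ∩ y ∣ ≡ᵇ 0

  count-disjoint : ∀ {n} (p : Subset n) → ∑ (vertices n) (λ y → ind (disjoint? y p)) ≡ ∣ ∁ p ∣ C 3
  count-disjoint {n} p = trans (∑-filter (isVertex n 3) (allSubsets n) _) (count-avoiding p 3)

  infix 4 _≟ˢ_
  _≟ˢ_ : ∀ {n} → DecidableEquality (Subset n)
  _≟ˢ_ = ≡-dec Bool._≟_

  ∑-allFin : ∀ {n} (φ : Fin (suc n) → ℕ) → ∑ (allFin (suc n)) φ ≡ φ zero + ∑ (allFin n) (φ ∘ suc)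
  ∑-allFin {n} φ = cong (φ zero +_) (trans (cong (λ xs → ∑ xs φ) (sym (map-tabulate id suc))) (∑-map suc (allFin n) φ))

  ∑-lookup : ∀ {n} (x : Subset n) → ∑ (allFin n) (λ a → ind (lookup x a)) ≡ ∣ x ∣
  ∑-lookup []          = refl
  ∑-lookup (true  ∷ x) = trans (∑-allFin (λ a → ind (lookup (true ∷ x) a))) (cong suc (∑-lookup x))
  ∑-lookup (false ∷ x) = trans (∑-allFin (λ a → ind (lookup (false ∷ x) a))) (∑-lookup x)

  ∣x∩y∣≡0⇒Adj : ∀ {n} {x y : Subset n} → ∣ x ∩ y ∣ ≡ 0 → Adj n x y
  ∣x∩y∣≡0⇒Adj {n} {x} {y} eq (a , a∈) with () ← subst (_≤ 0) (∣⁅x⁆∣≡1 a)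
    (subst (∣ ⁅ a ⁆ ∣ ≤_) eq (p⊆q⇒∣p∣≤∣q∣ λ b∈ → subst (Subset._∈ (x ∩ y)) (sym (x∈⁅y⁆⇒x≡y a b∈)) a∈))

  Adj⇒∣x∩y∣≡0 : ∀ {n} {x y : Subset n} → Adj n x y → ∣ x ∩ y ∣ ≡ 0
  Adj⇒∣x∩y∣≡0 {n} e = trans (cong ∣_∣ (Empty-unique e)) (∣⊥∣≡0 n)

  -- Binomial coefficients enter the polynomial identities only through their multiples by 2 and by
  -- 6, so that nothing has to be divided.
  2*C2 : ∀ m → 2 * (suc m C 2) ≡ suc m * m
  2*C2 zero    = refl
  2*C2 (suc m) = begin
    2 * (suc (suc m) C 2)               ≡⟨ cong (2 *_) (nCk+nC[k+1]≡[n+1]C[k+1] (suc m) 1) ⟨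
    2 * (suc m C 1 + suc m C 2)         ≡⟨ *-distribˡ-+ 2 (suc m C 1) (suc m C 2) ⟩
    2 * (suc m C 1) + 2 * (suc m C 2)   ≡⟨ cong₂ (λ i j → 2 * i + j) (nC1≡n (suc m)) (2*C2 m) ⟩
    2 * suc m + suc m * m               ≡⟨ arith m ⟩
    suc (suc m) * suc m                 ∎
    where
    arith : ∀ m → 2 * suc m + suc m * m ≡ suc (suc m) * suc m
    arith = solve-∀

  6*C3 : ∀ m → 6 * (suc (suc m) C 3) ≡ suc (suc m) * suc m * m
  6*C3 zero    = refl
  6*C3 (suc m) = begin
    6 * ((3 + m) C 3)                         ≡⟨ cong (6 *_) (nCk+nC[k+1]≡[n+1]C[k+1] (2 + m) 2) ⟨
    6 * ((2 + m) C 2 + (2 + m) C 3)           ≡⟨ arith₁ ((2 + m) C 2) ((2 + m) C 3) ⟩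
    3 * (2 * ((2 + m) C 2)) + 6 * ((2 + m) C 3) ≡⟨ cong₂ (λ i j → 3 * i + j) (2*C2 (suc m)) (6*C3 m) ⟩
    3 * ((2 + m) * suc m) + (2 + m) * suc m * m ≡⟨ arith₂ m ⟩
    (3 + m) * (2 + m) * suc m                 ∎
    where
    arith₁ : ∀ i j → 6 * (i + j) ≡ 3 * (2 * i) + 6 * j
    arith₁ = solve-∀
    arith₂ : ∀ m → 3 * ((2 + m) * suc m) + (2 + m) * suc m * m ≡ (3 + m) * (2 + m) * suc m
    arith₂ = solve-∀

  -- Serves twice: as 3 C(n,3) = n M, which compares the number of vertices with the size of a star,
  -- and as 3 d = (n - 3) μ, which compares the degree with the least eigenvalue.
  3*C3 : ∀ m → 3 * ((3 + m) C 3) ≡ (3 + m) * ((2 + m) C 2)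
  3*C3 m = *-cancelˡ-≡ _ _ 2 (begin
    2 * (3 * ((3 + m) C 3))         ≡⟨ *-assoc 2 3 ((3 + m) C 3) ⟨
    6 * ((3 + m) C 3)               ≡⟨ 6*C3 (1 + m) ⟩
    (3 + m) * (2 + m) * (1 + m)     ≡⟨ *-assoc (3 + m) (2 + m) (1 + m) ⟩
    (3 + m) * ((2 + m) * (1 + m))   ≡⟨ cong ((3 + m) *_) (2*C2 (1 + m)) ⟨
    (3 + m) * (2 * ((2 + m) C 2))   ≡⟨ arith (3 + m) ((2 + m) C 2) ⟩
    2 * ((3 + m) * ((2 + m) C 2))   ∎)
    where
    arith : ∀ p q → p * (2 * q) ≡ 2 * (p * q)
    arith = solve-∀

  -- For k = n - 1 this is the ratio attained by the complement of a star: C(n-1,3) deleted triples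
  -- against C(n-1,2) isolated ones.
  3*C3≡[k-2]*C2 : ∀ {k} → 2 ≤ k → 3 * (k C 3) ≡ (k ∸ 2) * (k C 2)
  3*C3≡[k-2]*C2 {suc (suc m)} (s≤s (s≤s z≤n)) = *-cancelˡ-≡ _ _ 2 (begin
    2 * (3 * ((2 + m) C 3))         ≡⟨ *-assoc 2 3 ((2 + m) C 3) ⟨
    6 * ((2 + m) C 3)               ≡⟨ 6*C3 m ⟩
    (2 + m) * (1 + m) * m           ≡⟨ cong (_* m) (2*C2 (1 + m)) ⟨
    2 * ((2 + m) C 2) * m           ≡⟨ arith m ((2 + m) C 2) ⟩
    2 * (m * ((2 + m) C 2))         ∎)
    where
    arith : ∀ p q → 2 * q * p ≡ 2 * (p * q)
    arith = solve-∀

  3*C3-∸ : ∀ {n} → 3 ≤ n → 3 * (n C 3) ≡ n * ((n ∸ 1) C 2)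
  3*C3-∸ {suc (suc (suc m))} (s≤s (s≤s (s≤s z≤n))) = 3*C3 m

  ∣∪∣+∣∩∣ : ∀ {n} (p q : Subset n) → ∣ p ∪ q ∣ + ∣ p ∩ q ∣ ≡ ∣ p ∣ + ∣ q ∣
  ∣∪∣+∣∩∣ []          []          = refl
  ∣∪∣+∣∩∣ (true  ∷ p) (true  ∷ q) = cong suc (trans (+-suc ∣ p ∪ q ∣ _) (trans (cong suc (∣∪∣+∣∩∣ p q)) (sym (+-suc ∣ p ∣ _))))
  ∣∪∣+∣∩∣ (true  ∷ p) (false ∷ q) = cong suc (∣∪∣+∣∩∣ p q)
  ∣∪∣+∣∩∣ (false ∷ p) (true  ∷ q) = trans (cong suc (∣∪∣+∣∩∣ p q)) (sym (+-suc ∣ p ∣ _))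
  ∣∪∣+∣∩∣ (false ∷ p) (false ∷ q) = ∣∪∣+∣∩∣ p q

  disjoint?-⊥ : ∀ {n} (y : Subset n) → disjoint? y ⊥ ≡ true
  disjoint?-⊥ {n} y = cong (_≡ᵇ 0) (trans (cong ∣_∣ (∩-zeroʳ y)) (∣⊥∣≡0 n))

  disjoint?-⁅⁆ : ∀ {n} (y : Subset n) a → disjoint? y ⁅ a ⁆ ≡ not (lookup y a)
  disjoint?-⁅⁆ (true  ∷ y) zero    = refl
  disjoint?-⁅⁆ (false ∷ y) zero    = disjoint?-⊥ y
  disjoint?-⁅⁆ (true  ∷ y) (suc a) = disjoint?-⁅⁆ y a
  disjoint?-⁅⁆ (false ∷ y) (suc a) = disjoint?-⁅⁆ y a

  disjoint?-∪ : ∀ {n} (y p q : Subset n) → disjoint? y (p ∪ q) ≡ disjoint? y p ∧ disjoint? y q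
  disjoint?-∪ []          []          []          = refl
  disjoint?-∪ (false ∷ y) (_     ∷ p) (_     ∷ q) = disjoint?-∪ y p q
  disjoint?-∪ (true  ∷ y) (true  ∷ p) (_     ∷ q) = refl
  disjoint?-∪ (true  ∷ y) (false ∷ p) (true  ∷ q) = sym (∧-zeroʳ _)
  disjoint?-∪ (true  ∷ y) (false ∷ p) (false ∷ q) = disjoint?-∪ y p q

  ∣∁⁅a⁆∣ : ∀ {m} (a : Fin (suc m)) → ∣ ∁ ⁅ a ⁆ ∣ ≡ m
  ∣∁⁅a⁆∣ a = trans (∣∁p∣≡n∸∣p∣ ⁅ a ⁆) (cong (suc _ ∸_) (∣⁅x⁆∣≡1 a))

  ∣⁅a⁆∪⁅b⁆∣ : ∀ {n} {a b : Fin n} → a ≢ b → ∣ ⁅ a ⁆ ∪ ⁅ b ⁆ ∣ ≡ 2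
  ∣⁅a⁆∪⁅b⁆∣ {n} {a} {b} a≢b = begin
    ∣ ⁅ a ⁆ ∪ ⁅ b ⁆ ∣                      ≡⟨ +-identityʳ _ ⟨
    ∣ ⁅ a ⁆ ∪ ⁅ b ⁆ ∣ + 0                  ≡⟨ cong (∣ ⁅ a ⁆ ∪ ⁅ b ⁆ ∣ +_) (Adj⇒∣x∩y∣≡0 disj) ⟨
    ∣ ⁅ a ⁆ ∪ ⁅ b ⁆ ∣ + ∣ ⁅ a ⁆ ∩ ⁅ b ⁆ ∣  ≡⟨ ∣∪∣+∣∩∣ ⁅ a ⁆ ⁅ b ⁆ ⟩
    ∣ ⁅ a ⁆ ∣ + ∣ ⁅ b ⁆ ∣                  ≡⟨ cong₂ _+_ (∣⁅x⁆∣≡1 a) (∣⁅x⁆∣≡1 b) ⟩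
    2                                      ∎
    where
    disj : Adj n ⁅ a ⁆ ⁅ b ⁆
    disj (c , c∈) = a≢b (trans (sym (x∈⁅y⁆⇒x≡y a (p∩q⊆p ⁅ a ⁆ ⁅ b ⁆ c∈))) (x∈⁅y⁆⇒x≡y b (p∩q⊆q ⁅ a ⁆ ⁅ b ⁆ c∈)))

  count-vertices : ∀ n → ∑ (vertices n) (λ _ → 1) ≡ n C 3
  count-vertices n = begin
    ∑ (vertices n) (λ _ → 1)                      ≡⟨ ∑-cong (vertices n) (λ {y} _ → cong ind (disjoint?-⊥ y)) ⟨
    ∑ (vertices n) (λ y → ind (disjoint? y ⊥))    ≡⟨ count-disjoint {n} ⊥ ⟩
    ∣ ∁ {n} ⊥ ∣ C 3                               ≡⟨ cong (_C 3) (trans (∣∁p∣≡n∸∣p∣ {n} ⊥) (cong (n ∸_) (∣⊥∣≡0 n))) ⟩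
    n C 3                                         ∎

  count-∌ : ∀ {m} (a : Fin (suc m)) → ∑ (vertices (suc m)) (λ y → ind (not (lookup y a))) ≡ m C 3
  count-∌ {m} a = begin
    ∑ (vertices (suc m)) (λ y → ind (not (lookup y a)))
      ≡⟨ ∑-cong (vertices (suc m)) (λ {y} _ → cong ind (disjoint?-⁅⁆ y a)) ⟨
    ∑ (vertices (suc m)) (λ y → ind (disjoint? y ⁅ a ⁆)) ≡⟨ count-disjoint ⁅ a ⁆ ⟩
    ∣ ∁ ⁅ a ⁆ ∣ C 3                                      ≡⟨ cong (_C 3) (∣∁⁅a⁆∣ a) ⟩
    m C 3                                                ∎

  ind-not : ∀ b → ind b + ind (not b) ≡ 1
  ind-not true  = refl
  ind-not false = refl

  count-∋ : ∀ {m} (a : Fin (suc m)) → ∑ (vertices (suc m)) (λ y → ind (lookup y a)) ≡ m C 2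
  count-∋ {m} a = +-cancelʳ-≡ (m C 3) _ (m C 2) (begin
    ∑ V (λ y → ind (lookup y a)) + m C 3
      ≡⟨ cong (∑ V (λ y → ind (lookup y a)) +_) (count-∌ a) ⟨
    ∑ V (λ y → ind (lookup y a)) + ∑ V (λ y → ind (not (lookup y a)))   ≡⟨ ∑-+ V _ _ ⟨
    ∑ V (λ y → ind (lookup y a) + ind (not (lookup y a)))               ≡⟨ ∑-cong V (λ {y} _ → ind-not (lookup y a)) ⟩
    ∑ V (λ _ → 1)                                                       ≡⟨ count-vertices (suc m) ⟩
    suc m C 3                                                           ≡⟨ nCk+nC[k+1]≡[n+1]C[k+1] m 2 ⟨
    m C 2 + m C 3                                                       ∎)
    where V = vertices (suc m)

  -- Inclusion-exclusion from the avoiding counts: [a, b ∈ y] + [a ∉ y] + [b ∉ y] = 1 + [a, b ∉ y],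
  -- and the last event is disjointness from a two-point set.
  count-∋∋ : ∀ {m} {a b : Fin (2 + m)} → a ≢ b → ∑ (vertices (2 + m)) (λ y → ind (lookup y a ∧ lookup y b)) ≡ m
  count-∋∋ {m} {a} {b} a≢b = +-cancelʳ-≡ (suc m C 3 + suc m C 3) _ m (begin
    ∑ V both + (suc m C 3 + suc m C 3)                ≡⟨ cong (∑ V both +_) (cong₂ _+_ (count-∌ a) (count-∌ b)) ⟨
    ∑ V both + (∑ V ∌a + ∑ V ∌b)                      ≡⟨ cong (∑ V both +_) (∑-+ V ∌a ∌b) ⟨
    ∑ V both + ∑ V (λ y → ∌a y + ∌b y)                ≡⟨ ∑-+ V both _ ⟨
    ∑ V (λ y → both y + (∌a y + ∌b y))                ≡⟨ ∑-cong V (λ {y} _ → pointwise y) ⟩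
    ∑ V (λ y → 1 + ind (disjoint? y (⁅ a ⁆ ∪ ⁅ b ⁆))) ≡⟨ ∑-+ V _ _ ⟩
    ∑ V (λ _ → 1) + ∑ V (λ y → ind (disjoint? y (⁅ a ⁆ ∪ ⁅ b ⁆)))
      ≡⟨ cong₂ _+_ (count-vertices (2 + m)) (trans (count-disjoint (⁅ a ⁆ ∪ ⁅ b ⁆)) (cong (_C 3) (trans (∣∁p∣≡n∸∣p∣ (⁅ a ⁆ ∪ ⁅ b ⁆)) (cong (2 + m ∸_) (∣⁅a⁆∪⁅b⁆∣ a≢b))))) ⟩
    (2 + m) C 3 + m C 3                               ≡⟨ cong (_+ m C 3) (nCk+nC[k+1]≡[n+1]C[k+1] (suc m) 2) ⟨
    suc m C 2 + suc m C 3 + m C 3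
      ≡⟨ cong (λ i → i + suc m C 3 + m C 3) (nCk+nC[k+1]≡[n+1]C[k+1] m 1) ⟨
    m C 1 + m C 2 + suc m C 3 + m C 3                 ≡⟨ arith (m C 1) (m C 2) (suc m C 3) (m C 3) ⟩
    m C 1 + (m C 2 + m C 3 + suc m C 3)
      ≡⟨ cong₂ (λ i j → i + (j + suc m C 3)) (nC1≡n m) (nCk+nC[k+1]≡[n+1]C[k+1] m 2) ⟩
    m + (suc m C 3 + suc m C 3)                       ∎)
    where
    V = vertices (2 + m)
    both ∌a ∌b : Subset (2 + m) → ℕ
    both y = ind (lookup y a ∧ lookup y b)
    ∌a y = ind (not (lookup y a))
    ∌b y = ind (not (lookup y b))
    arith : ∀ p q r s → p + q + r + s ≡ p + (q + s + r)
    arith = solve-∀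
    cases : ∀ p q → ind (p ∧ q) + (ind (not p) + ind (not q)) ≡ 1 + ind (not p ∧ not q)
    cases true  true  = refl
    cases true  false = refl
    cases false true  = refl
    cases false false = refl
    pointwise : ∀ y → both y + (∌a y + ∌b y) ≡ 1 + ind (disjoint? y (⁅ a ⁆ ∪ ⁅ b ⁆))
    pointwise y = trans (cases (lookup y a) (lookup y b)) (cong (λ t → 1 + ind t)
      (sym (trans (disjoint?-∪ y ⁅ a ⁆ ⁅ b ⁆) (cong₂ _∧_ (disjoint?-⁅⁆ y a) (disjoint?-⁅⁆ y b)))))

-- The Hoffman inequality over ℤ by a sum of squares.

module HoffmanBound where
  open import Data.Integer hiding (∣_∣; suc)
  open import Data.Integer.Properties
  open import Data.Integer.Tactic.RingSolver using (solve-∀)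
  open import Data.Nat as ℕ using (ℕ; suc)
  open import Data.Nat.Combinatorics using (_C_)
  import Data.Nat.Properties as ℕ
  open Counting
  module ℕ∑ = Sums ℕ.+-*-commutativeSemiring
  open Sums +-*-commutativeSemiring
  open ≡-Reasoning

  private
    variable
      A B : Set

  pos-ind : ∀ b → + ℕ∑.ind b ≡ ind b
  pos-ind true  = refl
  pos-ind false = refl

  pos-∑ : ∀ (xs : List A) φ → + ℕ∑.∑ xs φ ≡ ∑ xs (λ x → + φ x)
  pos-∑ []       φ = refl
  pos-∑ (x ∷ xs) φ = trans (pos-+ (φ x) (ℕ∑.∑ xs φ)) (cong (_+_ (+ φ x)) (pos-∑ xs φ))

  ∑-nonneg : ∀ (xs : List A) {φ} → (∀ x → 0ℤ ≤ φ x) → 0ℤ ≤ ∑ xs φ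
  ∑-nonneg []       φ≥0 = ≤-refl
  ∑-nonneg (x ∷ xs) φ≥0 = +-mono-≤ (φ≥0 x) (∑-nonneg xs φ≥0)

  ∑-mono : ∀ (xs : List A) {φ ψ} → (∀ {x} → x ∈ xs → φ x ≤ ψ x) → ∑ xs φ ≤ ∑ xs ψ
  ∑-mono []       φ≤ψ = ≤-refl
  ∑-mono (x ∷ xs) φ≤ψ = +-mono-≤ (φ≤ψ (here refl)) (∑-mono xs (λ x∈ → φ≤ψ (there x∈)))

  term≤∑ : ∀ {xs : List A} {x} {φ} → (∀ x → 0ℤ ≤ φ x) → x ∈ xs → φ x ≤ ∑ xs φ
  term≤∑ {xs = x ∷ xs} {φ = φ} φ≥0 (here refl) =
    subst (_≤ φ x + ∑ xs φ) (+-identityʳ (φ x)) (+-monoʳ-≤ (φ x) (∑-nonneg xs φ≥0))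
  term≤∑ {xs = y ∷ xs} {x} {φ} φ≥0 (there x∈) =
    subst (_≤ φ y + ∑ xs φ) (+-identityˡ (φ x)) (+-mono-≤ (φ≥0 y) (term≤∑ φ≥0 x∈))

  square≥0 : ∀ i → 0ℤ ≤ i * i
  square≥0 (+ m)    = subst (0ℤ ≤_) (pos-* m m) (+≤+ ℕ.z≤n)
  square≥0 -[1+ m ] = +≤+ ℕ.z≤n

  -- Linear combinations as lists of coefficient-value pairs: on a concrete list
  -- ∑-lc distributes a sum over all its terms at once.
  lc : List (ℤ × ℤ) → ℤ
  lc []             = 0ℤ
  lc ((k , v) ∷ ts) = k * v + lc ts

  ∑-lc : ∀ (xs : List A) (ts : List (ℤ × (A → ℤ))) →
         ∑ xs (λ x → lc (map (λ (k , φ) → k , φ x) ts)) ≡ lc (map (λ (k , φ) → k , ∑ xs φ) ts)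
  ∑-lc xs []             = ∑-0 xs
  ∑-lc xs ((k , φ) ∷ ts) = trans (∑-+ xs (λ x → k * φ x) _) (cong₂ _+_ (∑-*ˡ xs k φ) (∑-lc xs ts))

  ∑∑-lc : ∀ (xs : List A) (ys : List B) (ts : List (ℤ × (A → B → ℤ))) →
          ∑ xs (λ x → ∑ ys (λ y → lc (map (λ (k , φ) → k , φ x y) ts))) ≡
          lc (map (λ (k , φ) → k , ∑ xs (λ x → ∑ ys (φ x))) ts)
  ∑∑-lc xs ys []             = trans (∑-cong xs (λ _ → ∑-0 ys)) (∑-0 xs)
  ∑∑-lc xs ys ((k , φ) ∷ ts) = begin
    ∑ xs (λ x → ∑ ys (λ y → k * φ x y + rest x y))
      ≡⟨ ∑-cong xs (λ {x} _ → trans (∑-+ ys (λ y → k * φ x y) (rest x)) (cong (_+ ∑ ys (rest x)) (∑-*ˡ ys k (φ x)))) ⟩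
    ∑ xs (λ x → k * ∑ ys (φ x) + ∑ ys (rest x))
      ≡⟨ ∑-+ xs (λ x → k * ∑ ys (φ x)) _ ⟩
    ∑ xs (λ x → k * ∑ ys (φ x)) + ∑ xs (λ x → ∑ ys (rest x))
      ≡⟨ cong₂ _+_ (∑-*ˡ xs k _) (∑∑-lc xs ys ts) ⟩
    _ ∎
    where
    rest : _ → _ → ℤ
    rest x y = lc (map (λ (k , φ) → k , φ x y) ts)

  χ : ∀ {n} → Subset n → Fin n → ℤ
  χ x a = ind (lookup x a)

  ∑-χ : ∀ {n} (x : Subset n) → ∑ (allFin n) (χ x) ≡ + ∣ x ∣
  ∑-χ {n} x = begin
    ∑ (allFin n) (χ x)                              ≡⟨ ∑-cong (allFin n) (λ {a} _ → pos-ind (lookup x a)) ⟨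
    ∑ (allFin n) (λ a → + ℕ∑.ind (lookup x a))      ≡⟨ pos-∑ (allFin n) _ ⟨
    + ℕ∑.∑ (allFin n) (λ a → ℕ∑.ind (lookup x a))   ≡⟨ cong +_ (∑-lookup x) ⟩
    + ∣ x ∣                                         ∎

  ∑-χχ : ∀ {n} (x y : Subset n) → ∑ (allFin n) (λ a → χ x a * χ y a) ≡ + ∣ x ∩ y ∣
  ∑-χχ {n} x y = trans (∑-cong (allFin n) λ {a} _ → sym (trans (cong ind (lookup-zipWith _∧_ a x y)) (ind-∧ (lookup x a) (lookup y a)))) (∑-χ (x ∩ y))

  -- The squared norm of a linear image of `f`, expanded through the Gram matrix of the rows of `u`.
  -- Applied to incidence with points, to incidence with ordered pairs of points, and, with the
  -- roles of points and triples exchanged, to `ℓ`.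
  ∑-gram : ∀ (as : List A) (xs : List B) (u : B → A → ℤ) (f : B → ℤ) →
           ∑ as (λ a → ∑ xs (λ x → u x a * f x) * ∑ xs (λ x → u x a * f x)) ≡
           ∑ xs (λ x → ∑ xs (λ y → ∑ as (λ a → u x a * u y a) * (f x * f y)))
  ∑-gram as xs u f = begin
    ∑ as (λ a → ∑ xs (λ x → u x a * f x) * ∑ xs (λ x → u x a * f x))
      ≡⟨ ∑-cong as (λ _ → ∑-product xs xs _ _) ⟨
    ∑ as (λ a → ∑ xs (λ x → ∑ xs (λ y → (u x a * f x) * (u y a * f y))))
      ≡⟨ ∑-comm as xs _ ⟩
    ∑ xs (λ x → ∑ as (λ a → ∑ xs (λ y → (u x a * f x) * (u y a * f y))))
      ≡⟨ ∑-cong xs (λ {x} _ → trans (∑-comm as xs _) (∑-cong xs λ {y} _ →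
           trans (∑-cong as (λ {a} _ → rearrange (u x a) (f x) (u y a) (f y))) (∑-*ʳ as (f x * f y) (λ a → u x a * u y a)))) ⟩
    _ ∎
    where
    rearrange : ∀ p q r s → (p * q) * (r * s) ≡ (p * r) * (q * s)
    rearrange = solve-∀

  ∣x∩y∣≡3⇒x≡y : ∀ {n} {x y : Subset n} → ∣ x ∣ ≡ 3 → ∣ y ∣ ≡ 3 → ∣ x ∩ y ∣ ≡ 3 → x ≡ y
  ∣x∩y∣≡3⇒x≡y {x = x} {y} ∣x∣ ∣y∣ ∣x∩y∣ = trans (sym (full (p∩q⊆p x y) ∣x∣)) (full (p∩q⊆q x y) ∣y∣)
    where
    full : ∀ {z} → x ∩ y ⊆ z → ∣ z ∣ ≡ 3 → x ∩ y ≡ z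
    full {z} ⊆z ∣z∣ = ⊆-antisym ⊆z λ {a} a∈z → decidable-stable (a ∈? (x ∩ y)) λ a∉ →
      ℕ.<⇒≢ (p⊂q⇒∣p∣<∣q∣ (⊆z , a , a∈z , a∉)) (trans ∣x∩y∣ (sym ∣z∣))

  -- [i = 0] = 1 − i + C(i,2) − C(i,3) for the intersection size i ≤ 3, doubled.
  disjoint?-polynomial : ∀ {n} {x y : Subset n} → ∣ x ∣ ≡ 3 → ∣ y ∣ ≡ 3 → let i = + ∣ x ∩ y ∣ in
    + 2 * ind (disjoint? x y) ≡ + 2 + - + 3 * i + i * i + - + 2 * ind (does (x ≟ˢ y))
  disjoint?-polynomial {x = x} {y} ∣x∣ ∣y∣ with ∣ x ∩ y ∣ in eq | x ≟ˢ y
  ... | i | yes refl with refl ← trans (sym eq) (trans (cong ∣_∣ (∩-idem x)) ∣x∣) = refl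
  ... | 0 | no _ = refl
  ... | 1 | no _ = refl
  ... | 2 | no _ = refl
  ... | 3 | no x≢y = contradiction (∣x∩y∣≡3⇒x≡y ∣x∣ ∣y∣ eq) x≢y
  ... | suc (suc (suc (suc _))) | no _ with ℕ.s≤s (ℕ.s≤s (ℕ.s≤s ())) ← subst₂ ℕ._≤_ eq ∣x∣ (∣p∩q∣≤∣p∣ x y)

  module Weights {n} (f : Subset n → ℤ) where
    V : List (Subset n)
    V = vertices n

    I : List (Fin n)
    I = allFin n

    g : Fin n → ℤ
    g a = ∑ V (λ x → χ x a * f x)

    h : Fin n → Fin n → ℤ
    h a b = ∑ V (λ x → (χ x a * χ x b) * f x)

    -- The matrix with entries |x ∩ y| applied to `f`. Up to scaling and a constant, it carries the
    -- component of `f` in the span of the stars.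
    ℓ : Subset n → ℤ
    ℓ x = ∑ I (λ a → χ x a * g a)

    ∑f ∑f² ∑g² ∑h² disjointPairs : ℤ
    ∑f  = ∑ V f
    ∑f² = ∑ V (λ x → f x * f x)
    ∑g² = ∑ I (λ a → g a * g a)
    ∑h² = ∑ I (λ a → ∑ I (λ b → h a b * h a b))
    disjointPairs = ∑ V (λ x → ∑ V (λ y → ind (disjoint? x y) * (f x * f y)))

    h-diagonal : ∀ a → h a a ≡ g a
    h-diagonal a = ∑-cong V λ {x} _ → cong (_* f x) (ind-idem (lookup x a))

    ∑g≡3∑f : ∑ I g ≡ + 3 * ∑f
    ∑g≡3∑f = begin
      ∑ I g                                      ≡⟨ ∑-comm I V _ ⟩
      ∑ V (λ x → ∑ I (λ a → χ x a * f x))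
        ≡⟨ ∑-cong V (λ {x} x∈ → trans (∑-*ʳ I (f x) (χ x)) (cong (_* f x) (trans (∑-χ x) (cong +_ (∈-vertices⁻ x∈))))) ⟩
      ∑ V (λ x → + 3 * f x)                      ≡⟨ ∑-*ˡ V (+ 3) f ⟩
      + 3 * ∑f                                   ∎

    ∑h≡3g : ∀ a → ∑ I (h a) ≡ + 3 * g a
    ∑h≡3g a = begin
      ∑ I (h a)
        ≡⟨ ∑-comm I V _ ⟩
      ∑ V (λ x → ∑ I (λ b → (χ x a * χ x b) * f x))
        ≡⟨ ∑-cong V (λ {x} x∈ → trans (∑-*ʳ I (f x) (λ b → χ x a * χ x b)) (cong (_* f x) (trans (∑-*ˡ I (χ x a) (χ x)) (cong (χ x a *_) (trans (∑-χ x) (cong +_ (∈-vertices⁻ x∈))))))) ⟩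
      ∑ V (λ x → (χ x a * + 3) * f x)
        ≡⟨ ∑-cong V (λ {x} _ → rearrange (χ x a) (f x)) ⟩
      ∑ V (λ x → + 3 * (χ x a * f x))
        ≡⟨ ∑-*ˡ V (+ 3) _ ⟩
      + 3 * g a ∎
      where
      rearrange : ∀ p q → (p * + 3) * q ≡ + 3 * (p * q)
      rearrange = solve-∀

    ∑g²-pairs : ∑g² ≡ ∑ V (λ x → ∑ V (λ y → + ∣ x ∩ y ∣ * (f x * f y)))
    ∑g²-pairs = trans (∑-gram I V χ f) (∑-cong V λ {x} _ → ∑-cong V λ {y} _ → cong (_* (f x * f y)) (∑-χχ x y))

    -- The Gram entry of x and y counts the ordered pairs (a, b), with a = b allowed, that lie in
    -- both; this factors as |x ∩ y| · |x ∩ y|.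
    ∑h²-pairs : ∑h² ≡ ∑ V (λ x → ∑ V (λ y → (+ ∣ x ∩ y ∣ * + ∣ x ∩ y ∣) * (f x * f y)))
    ∑h²-pairs = begin
      ∑h²
        ≡⟨ ∑-cong I (λ {a} _ → ∑-gram I V (λ x b → χ x a * χ x b) f) ⟩
      ∑ I (λ a → ∑ V (λ x → ∑ V (λ y → ∑ I (λ b → (χ x a * χ x b) * (χ y a * χ y b)) * (f x * f y))))
        ≡⟨ ∑-comm I V _ ⟩
      ∑ V (λ x → ∑ I (λ a → ∑ V (λ y → ∑ I (λ b → (χ x a * χ x b) * (χ y a * χ y b)) * (f x * f y))))
        ≡⟨ ∑-cong V (λ {x} _ → ∑-comm I V _) ⟩
      ∑ V (λ x → ∑ V (λ y → ∑ I (λ a → ∑ I (λ b → (χ x a * χ x b) * (χ y a * χ y b)) * (f x * f y))))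
        ≡⟨ ∑-cong V (λ {x} _ → ∑-cong V λ {y} _ → trans (∑-*ʳ I (f x * f y) _) (cong (_* (f x * f y)) (inner x y))) ⟩
      _ ∎
      where
      rearrange : ∀ p q r s → (p * q) * (r * s) ≡ (p * r) * (q * s)
      rearrange = solve-∀
      inner : ∀ x y → ∑ I (λ a → ∑ I (λ b → (χ x a * χ x b) * (χ y a * χ y b))) ≡ + ∣ x ∩ y ∣ * + ∣ x ∩ y ∣
      inner x y = begin
        ∑ I (λ a → ∑ I (λ b → (χ x a * χ x b) * (χ y a * χ y b)))
          ≡⟨ ∑-cong I (λ {a} _ → ∑-cong I λ {b} _ → rearrange (χ x a) (χ x b) (χ y a) (χ y b)) ⟩
        ∑ I (λ a → ∑ I (λ b → (χ x a * χ y a) * (χ x b * χ y b)))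
          ≡⟨ ∑-product I I _ _ ⟩
        ∑ I (λ a → χ x a * χ y a) * ∑ I (λ b → χ x b * χ y b)
          ≡⟨ cong₂ _*_ (∑-χχ x y) (∑-χχ x y) ⟩
        _ ∎

    -- The polynomial for disjointness, weighted by f x · f y and summed: the linear and quadratic
    -- terms in |x ∩ y| become `∑g²` and `∑h²`. The cubic term C(|x ∩ y|, 3) is the indicator of x =
    -- y, hence `∑f²`, so no sum over triples of points is required.
    2disjointPairs : + 2 * disjointPairs ≡ + 2 * (∑f * ∑f) - + 3 * ∑g² + ∑h² - + 2 * ∑f²
    2disjointPairs = begin
      + 2 * disjointPairs
        ≡⟨ trans (sym (∑-*ˡ V (+ 2) _)) (∑-cong V λ _ → sym (∑-*ˡ V (+ 2) _)) ⟩
      ∑ V (λ x → ∑ V (λ y → + 2 * (ind (disjoint? x y) * (f x * f y))))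
        ≡⟨ ∑-cong V (λ {x} x∈ → ∑-cong V λ {y} y∈ → trans (sym (*-assoc (+ 2) (ind (disjoint? x y)) (f x * f y)))
             (trans (cong (_* (f x * f y)) (disjoint?-polynomial {x = x} {y} (∈-vertices⁻ x∈) (∈-vertices⁻ y∈)))
                    (split (+ ∣ x ∩ y ∣) (ind (does (x ≟ˢ y))) (f x) (f y)))) ⟩
      ∑ V (λ x → ∑ V (λ y → lc (map (λ (k , φ) → k , φ x y) terms)))
        ≡⟨ ∑∑-lc V V terms ⟩
      lc (map (λ (k , φ) → k , ∑ V (λ x → ∑ V (φ x))) terms)
        ≡⟨ collect (∑-product V V f f) (sym ∑g²-pairs) (sym ∑h²-pairs) diagonal ⟩
      + 2 * (∑f * ∑f) - + 3 * ∑g² + ∑h² - + 2 * ∑f² ∎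
      where
      terms : List (ℤ × (Subset n → Subset n → ℤ))
      terms = (+ 2 , λ x y → f x * f y) ∷ (- + 3 , λ x y → + ∣ x ∩ y ∣ * (f x * f y))
            ∷ (+ 1 , λ x y → (+ ∣ x ∩ y ∣ * + ∣ x ∩ y ∣) * (f x * f y))
            ∷ (- + 2 , λ x y → ind (does (x ≟ˢ y)) * (f x * f y)) ∷ []
      split : ∀ i e p q → (+ 2 + - + 3 * i + i * i + - + 2 * e) * (p * q) ≡
        + 2 * (p * q) + (- + 3 * (i * (p * q)) + (+ 1 * ((i * i) * (p * q)) + (- + 2 * (e * (p * q)) + 0ℤ)))
      split = solve-∀
      diagonal : ∑ V (λ x → ∑ V (λ y → ind (does (x ≟ˢ y)) * (f x * f y))) ≡ ∑f²
      diagonal = ∑-cong V λ {x} x∈ → ∑-δ _≟ˢ_ (λ y → f x * f y) (vertices-unique n) x∈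
      collect : ∀ {p p′ q q′ r r′ s s′} → p ≡ p′ → q ≡ q′ → r ≡ r′ → s ≡ s′ →
        lc ((+ 2 , p) ∷ (- + 3 , q) ∷ (+ 1 , r) ∷ (- + 2 , s) ∷ []) ≡ + 2 * p′ - + 3 * q′ + r′ - + 2 * s′
      collect {p} {_} {q} {_} {r} {_} {s} refl refl refl refl = eq p q r s
        where
        eq : ∀ p q r s → + 2 * p + (- + 3 * q + (+ 1 * r + (- + 2 * s + 0ℤ))) ≡ + 2 * p - + 3 * q + r - + 2 * s
        eq = solve-∀

  -- On K(n,3) the Hoffman form Σ_{x disjoint from y} f x · f y + μ Σ f² − (μ/M) (Σ f)² equals
  -- Σ_{a<b} r(a,b)² + (μ − 1) Σ_x t(x)², where r and t are what remains of the codegrees h and of f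
  -- after subtracting their components in the span of the stars.  Here k = n − 3, and r and t are
  -- scaled by P = (n − 1)(n − 2) and D = P (n − 3) to have integral coefficients; F, E, G and H stand
  -- for Σ f, Σ f², Σ g² and Σ h², the degrees being g a = h a a.
  sum-of-squares : ∀ k F G H E →
    let P = (k + + 2) * (k + + 1)
        Q = - + 2 * (k + + 2)
        D = P * k
        n = k + + 3
        μ₂ = (k - + 1) * (k - + 2)
        R = P * P * H + + 12 * (P * Q) * G + + 108 * P * (F * F)
          + Q * Q * (+ 2 * n * G + + 18 * (F * F)) + + 72 * Q * n * (F * F) + + 36 * (n * n) * (F * F)
        Δ = (P + + 2 * Q) * (P + + 2 * Q) * G + + 36 * (P + + 2 * Q) * (F * F) + + 36 * n * (F * F)
        T = D * D * E + + 2 * D * Q * G + + 24 * D * (F * F) + Q * Q * ((k + + 1) * (+ 9 * (F * F)))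
          + + 2 * ((k + + 2) * (k + + 2)) * (P - + 2 * (k + + 1)) * G + + 36 * Q * P * (F * F) + + 24 * (n * P) * (F * F)
    in D * D * (P * (+ 2 * (F * F) - + 3 * G + H - + 2 * E) + P * μ₂ * E - + 2 * μ₂ * (F * F))
       ≡ P * (k * k * (R - Δ) + (μ₂ - + 2) * T)
  sum-of-squares = solve-∀

  -- The values of M = C(n-1,2) and N = C(n,3) are given by equations for 2 M and 6 N. Here the sum
  -- of the t(x)² is rewritten in these multiples, ready for substitution.
  double-counts : ∀ k M N F G E →
    let P = (k + + 2) * (k + + 1)
        Q = - + 2 * (k + + 2)
        D = P * k
        S = + 2 * M
        U = + 6 * N in
    D * D * E + + 2 * D * Q * G + + 24 * D * (F * F) + Q * Q * ((k + + 1) * (+ 9 * (F * F)))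
    + Q * Q * (M - (k + + 1)) * G + + 72 * Q * M * (F * F) + + 144 * N * (F * F) ≡
    D * D * E + + 2 * D * Q * G + + 24 * D * (F * F) + Q * Q * ((k + + 1) * (+ 9 * (F * F)))
    + + 2 * ((k + + 2) * (k + + 2)) * (S - + 2 * (k + + 1)) * G + + 36 * Q * S * (F * F) + + 24 * U * (F * F)
  double-counts = solve-∀

  ∑-const : ∀ {A : Set} (xs : List A) k → ∑ xs (λ _ → k) ≡ + length xs * k
  ∑-const []       k = sym (*-zeroˡ k)
  ∑-const (x ∷ xs) k = sym (trans (cong (_* k) (pos-+ 1 (length xs))) (trans (*-distribʳ-+ k 1ℤ (+ length xs))
    (cong₂ _+_ (*-identityˡ k) (sym (∑-const xs k)))))

  ∑-const-Fin : ∀ n k → ∑ (allFin n) (λ _ → k) ≡ + n * k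
  ∑-const-Fin n k = trans (∑-const (allFin n) k) (cong (λ i → + i * k) (length-tabulate {n = n} (λ i → i)))

  -- Subtracting the diagonal from the full double sum leaves the sum of squares over a ≠ b, and
  -- this shows it to be nonnegative without summing over distinct pairs.
  ∑∑-diagonal≤ : ∀ {A : Set} (xs : List A) (φ : A → A → ℤ) →
                 ∑ xs (λ a → φ a a * φ a a) ≤ ∑ xs (λ a → ∑ xs (λ b → φ a b * φ a b))
  ∑∑-diagonal≤ xs φ = ∑-mono xs λ {a} a∈ → term≤∑ {φ = λ b → φ a b * φ a b} (λ b → square≥0 (φ a b)) a∈

  r²-form diagonal-form : (p q n F G H : ℤ) → ℤ
  r²-form p q n F G H =
    p * p * H + + 12 * (p * q) * G + + 108 * p * (F * F)
    + q * q * (+ 2 * n * G + + 18 * (F * F)) + + 72 * q * n * (F * F) + + 36 * (n * n) * (F * F)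
  diagonal-form p q n F G H =
    (p + + 2 * q) * (p + + 2 * q) * G + + 36 * (p + + 2 * q) * (F * F) + + 36 * n * (F * F)

  t²-form : (p q m M N F E G : ℤ) → ℤ
  t²-form p q m M N F E G =
    p * p * E + + 2 * p * q * G + + 24 * p * (F * F) + q * q * (m * (+ 9 * (F * F)))
    + q * q * (M - m) * G + + 72 * q * M * (F * F) + + 144 * N * (F * F)

  module _ (m : ℕ) where

    private
      V : List (Subset (2 ℕ.+ m))
      V = vertices (2 ℕ.+ m)

      star : ℤ
      star = + (suc m C 2)

    ∑1≡total : ∑ V (λ _ → 1ℤ) ≡ + ((2 ℕ.+ m) C 3)
    ∑1≡total = trans (sym (pos-∑ V (λ _ → 1))) (cong +_ (count-vertices (2 ℕ.+ m)))

    ∑-χ-vertices : ∀ a → ∑ V (λ x → χ x a) ≡ star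
    ∑-χ-vertices a = begin
      ∑ V (λ x → χ x a)                      ≡⟨ ∑-cong V (λ {x} _ → pos-ind (lookup x a)) ⟨
      ∑ V (λ x → + ℕ∑.ind (lookup x a))      ≡⟨ pos-∑ V _ ⟨
      + ℕ∑.∑ V (λ x → ℕ∑.ind (lookup x a))   ≡⟨ cong +_ (count-∋ a) ⟩
      star                                   ∎

    -- The Gram matrix of the stars. As n = m + 2 here, two distinct points lie in n - 2 common
    -- triples, which gives m J + (M - m) I with M the size of a star.
    ∑-χχ-vertices : ∀ a b → ∑ V (λ x → χ x a * χ x b) ≡ + m + ind (does (a Fin.≟ b)) * (star - + m)
    ∑-χχ-vertices a b with a Fin.≟ b
    ... | yes refl = trans (∑-cong V (λ {x} _ → ind-idem (lookup x a))) (trans (∑-χ-vertices a) (eq (+ m) star))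
      where
      eq : ∀ m M → M ≡ m + 1ℤ * (M - m)
      eq = solve-∀
    ... | no a≢b = begin
      ∑ V (λ x → χ x a * χ x b)
        ≡⟨ ∑-cong V (λ {x} _ → trans (pos-ind (lookup x a ∧ lookup x b)) (ind-∧ (lookup x a) (lookup x b))) ⟨
      ∑ V (λ x → + ℕ∑.ind (lookup x a ∧ lookup x b))      ≡⟨ pos-∑ V _ ⟨
      + ℕ∑.∑ V (λ x → ℕ∑.ind (lookup x a ∧ lookup x b))   ≡⟨ cong +_ (count-∋∋ a≢b) ⟩
      + m                                                 ≡⟨ +-identityʳ (+ m) ⟨
      + m + 0ℤ                                            ≡⟨ cong (_+_ (+ m)) (*-zeroˡ (star - + m)) ⟨
      + m + 0ℤ * (star - + m)                             ∎

  module Squares {n} (f : Subset n → ℤ) where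
    open Weights f

    ∑∑gₐ : ∀ φ → ∑ I (λ a → ∑ I (λ _ → φ a)) ≡ + n * ∑ I φ
    ∑∑gₐ φ = trans (∑-cong I (λ {a} _ → ∑-const-Fin n (φ a))) (∑-*ˡ I (+ n) φ)

    ∑∑gb : ∀ φ → ∑ I (λ _ → ∑ I φ) ≡ + n * ∑ I φ
    ∑∑gb φ = ∑-const-Fin n (∑ I φ)

    ∑∑ghₐ : ∑ I (λ a → ∑ I (λ b → h a b * g a)) ≡ + 3 * ∑g²
    ∑∑ghₐ = begin
      ∑ I (λ a → ∑ I (λ b → h a b * g a))
        ≡⟨ ∑-cong I (λ {a} _ → trans (∑-*ʳ I (g a) (h a)) (trans (cong (_* g a) (∑h≡3g a)) (*-assoc (+ 3) (g a) (g a)))) ⟩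
      ∑ I (λ a → + 3 * (g a * g a))        ≡⟨ ∑-*ˡ I (+ 3) _ ⟩
      + 3 * ∑g²                            ∎

    ∑∑ghb : ∑ I (λ a → ∑ I (λ b → h a b * g b)) ≡ + 3 * ∑g²
    ∑∑ghb = begin
      ∑ I (λ a → ∑ I (λ b → h a b * g b))  ≡⟨ ∑-comm I I _ ⟩
      ∑ I (λ b → ∑ I (λ a → h a b * g b))  ≡⟨ ∑-cong I (λ {b} _ → ∑-cong I λ {a} _ → cong (_* g b) (h-comm a b)) ⟩
      ∑ I (λ b → ∑ I (λ a → h b a * g b))  ≡⟨ ∑∑ghₐ ⟩
      + 3 * ∑g²                            ∎
      where
      h-comm : ∀ a b → h a b ≡ h b a
      h-comm a b = ∑-cong V λ {x} _ → cong (_* f x) (*-comm (χ x a) (χ x b))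

    ∑∑h : ∑ I (λ a → ∑ I (h a)) ≡ + 9 * ∑f
    ∑∑h = begin
      ∑ I (λ a → ∑ I (h a))   ≡⟨ ∑-cong I (λ {a} _ → ∑h≡3g a) ⟩
      ∑ I (λ a → + 3 * g a)   ≡⟨ ∑-*ˡ I (+ 3) g ⟩
      + 3 * ∑ I g             ≡⟨ cong (+ 3 *_) ∑g≡3∑f ⟩
      + 3 * (+ 3 * ∑f)        ≡⟨ *-assoc (+ 3) (+ 3) ∑f ⟨
      + 9 * ∑f                ∎

    ∑∑gg : ∑ I (λ a → ∑ I (λ b → g a * g b)) ≡ (+ 3 * ∑f) * (+ 3 * ∑f)
    ∑∑gg = trans (∑-product I I g g) (cong₂ _*_ ∑g≡3∑f ∑g≡3∑f)

    module _ (p q : ℤ) where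

      -- The coefficients are fixed by orthogonality: for p = (n - 1)(n - 2) and q = - 2 (n - 1),
      -- the values used later, the sum of r a b over all b ≠ a is 0 for every a. It uses that the h
      -- a b with b ≠ a sum to 2 g a and the g b to 3 Σ f.
      r : Fin n → Fin n → ℤ
      r a b = p * h a b + q * (g a + g b) + + 6 * ∑f

      ∑∑r² : ∑ I (λ a → ∑ I (λ b → r a b * r a b)) ≡ r²-form p q (+ n) ∑f ∑g² ∑h²
      ∑∑r² = begin
        ∑ I (λ a → ∑ I (λ b → r a b * r a b))
          ≡⟨ ∑-cong I (λ {a} _ → ∑-cong I λ {b} _ → expand p q (h a b) (g a) (g b) ∑f) ⟩
        ∑ I (λ a → ∑ I (λ b → lc (map (λ (k , φ) → k , φ a b) terms)))
          ≡⟨ ∑∑-lc I I terms ⟩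
        lc (map (λ (k , φ) → k , ∑ I (λ a → ∑ I (φ a))) terms)
          ≡⟨ collect refl ∑∑ghₐ ∑∑ghb ∑∑h (∑∑gₐ (λ a → g a * g a)) (∑∑gb (λ b → g b * g b)) ∑∑gg
               (trans (∑∑gₐ g) (cong (+ n *_) ∑g≡3∑f)) (trans (∑∑gb g) (cong (+ n *_) ∑g≡3∑f))
               (trans (∑∑gb (λ _ → 1ℤ)) (cong (+ n *_) (∑-const-Fin n 1ℤ))) ⟩
        r²-form p q (+ n) ∑f ∑g² ∑h² ∎
        where
        terms : List (ℤ × (Fin n → Fin n → ℤ))
        terms = (p * p , λ a b → h a b * h a b) ∷ (+ 2 * (p * q) , λ a b → h a b * g a) ∷ (+ 2 * (p * q) , λ a b → h a b * g b)
              ∷ (+ 12 * (p * ∑f) , h) ∷ (q * q , λ a _ → g a * g a) ∷ (q * q , λ _ b → g b * g b)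
              ∷ (+ 2 * (q * q) , λ a b → g a * g b) ∷ (+ 12 * (q * ∑f) , λ a _ → g a) ∷ (+ 12 * (q * ∑f) , λ _ b → g b)
              ∷ (+ 36 * (∑f * ∑f) , λ _ _ → 1ℤ) ∷ []
        expand : ∀ p q h ga gb F → (p * h + q * (ga + gb) + + 6 * F) * (p * h + q * (ga + gb) + + 6 * F) ≡
          p * p * (h * h) + (+ 2 * (p * q) * (h * ga) + (+ 2 * (p * q) * (h * gb) + (+ 12 * (p * F) * h + (q * q * (ga * ga)
          + (q * q * (gb * gb) + (+ 2 * (q * q) * (ga * gb) + (+ 12 * (q * F) * ga + (+ 12 * (q * F) * gb
          + (+ 36 * (F * F) * 1ℤ + 0ℤ)))))))))
        expand = solve-∀
        collect : ∀ {H c₁ c₂ c₃ c₄ c₅ c₆ c₇ c₈ c₉} → H ≡ ∑h² → c₁ ≡ + 3 * ∑g² → c₂ ≡ + 3 * ∑g² → c₃ ≡ + 9 * ∑f →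
          c₄ ≡ + n * ∑g² → c₅ ≡ + n * ∑g² → c₆ ≡ (+ 3 * ∑f) * (+ 3 * ∑f) → c₇ ≡ + n * (+ 3 * ∑f) → c₈ ≡ + n * (+ 3 * ∑f) →
          c₉ ≡ + n * (+ n * 1ℤ) →
          p * p * H + (+ 2 * (p * q) * c₁ + (+ 2 * (p * q) * c₂ + (+ 12 * (p * ∑f) * c₃ + (q * q * c₄
          + (q * q * c₅ + (+ 2 * (q * q) * c₆ + (+ 12 * (q * ∑f) * c₇ + (+ 12 * (q * ∑f) * c₈
          + (+ 36 * (∑f * ∑f) * c₉ + 0ℤ))))))))) ≡ r²-form p q (+ n) ∑f ∑g² ∑h²
        collect refl refl refl refl refl refl refl refl refl refl = eq p q (+ n) ∑f ∑g² ∑h²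
          where
          eq : ∀ p q n F G H →
            p * p * H + (+ 2 * (p * q) * (+ 3 * G) + (+ 2 * (p * q) * (+ 3 * G) + (+ 12 * (p * F) * (+ 9 * F) + (q * q * (n * G)
            + (q * q * (n * G) + (+ 2 * (q * q) * ((+ 3 * F) * (+ 3 * F)) + (+ 12 * (q * F) * (n * (+ 3 * F)) + (+ 12 * (q * F) * (n * (+ 3 * F))
            + (+ 36 * (F * F) * (n * (n * 1ℤ)) + 0ℤ)))))))))
            ≡ p * p * H + + 12 * (p * q) * G + + 108 * p * (F * F)
             + q * q * (+ 2 * n * G + + 18 * (F * F)) + + 72 * q * n * (F * F) + + 36 * (n * n) * (F * F)
          eq = solve-∀

      ∑r²-diagonal : ∑ I (λ a → r a a * r a a) ≡ diagonal-form p q (+ n) ∑f ∑g² ∑h²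
      ∑r²-diagonal = begin
        ∑ I (λ a → r a a * r a a)
          ≡⟨ ∑-cong I (λ {a} _ → trans (cong (λ h → (p * h + q * (g a + g a) + + 6 * ∑f) * (p * h + q * (g a + g a) + + 6 * ∑f)) (h-diagonal a))
               (expand p q (g a) ∑f)) ⟩
        ∑ I (λ a → lc (map (λ (k , φ) → k , φ a) terms))
          ≡⟨ ∑-lc I terms ⟩
        lc (map (λ (k , φ) → k , ∑ I φ) terms)
          ≡⟨ collect ∑g≡3∑f (∑-const-Fin n 1ℤ) ⟩
        diagonal-form p q (+ n) ∑f ∑g² ∑h² ∎
        where
        terms : List (ℤ × (Fin n → ℤ))
        terms = ((p + + 2 * q) * (p + + 2 * q) , λ a → g a * g a) ∷ (+ 12 * ((p + + 2 * q) * ∑f) , g) ∷ (+ 36 * (∑f * ∑f) , λ _ → 1ℤ) ∷ []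
        expand : ∀ p q g F → (p * g + q * (g + g) + + 6 * F) * (p * g + q * (g + g) + + 6 * F) ≡
          (p + + 2 * q) * (p + + 2 * q) * (g * g) + (+ 12 * ((p + + 2 * q) * F) * g + (+ 36 * (F * F) * 1ℤ + 0ℤ))
        expand = solve-∀
        collect : ∀ {c₁ c₂} → c₁ ≡ + 3 * ∑f → c₂ ≡ + n * 1ℤ →
          (p + + 2 * q) * (p + + 2 * q) * ∑g² + (+ 12 * ((p + + 2 * q) * ∑f) * c₁ + (+ 36 * (∑f * ∑f) * c₂ + 0ℤ)) ≡ diagonal-form p q (+ n) ∑f ∑g² ∑h²
        collect refl refl = eq p q (+ n) ∑f ∑g²
          where
          eq : ∀ p q n F G → (p + + 2 * q) * (p + + 2 * q) * G + (+ 12 * ((p + + 2 * q) * F) * (+ 3 * F) + (+ 36 * (F * F) * (n * 1ℤ) + 0ℤ))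
            ≡ (p + + 2 * q) * (p + + 2 * q) * G + + 36 * (p + + 2 * q) * (F * F) + + 36 * n * (F * F)
          eq = solve-∀

    ∑fℓ : ∑ V (λ x → f x * ℓ x) ≡ ∑g²
    ∑fℓ = begin
      ∑ V (λ x → f x * ℓ x)                         ≡⟨ ∑-cong V (λ {x} _ → ∑-*ˡ I (f x) _) ⟨
      ∑ V (λ x → ∑ I (λ a → f x * (χ x a * g a)))   ≡⟨ ∑-comm V I _ ⟩
      ∑ I (λ a → ∑ V (λ x → f x * (χ x a * g a)))
        ≡⟨ ∑-cong I (λ {a} _ → trans (∑-cong V λ {x} _ → rearrange (f x) (χ x a) (g a)) (∑-*ʳ V (g a) _)) ⟩
      ∑g²                                           ∎
      where
      rearrange : ∀ p q r → p * (q * r) ≡ (q * p) * r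
      rearrange = solve-∀

    module _ (m : ℤ) {star total : ℤ}
      (∑1 : ∑ (vertices n) (λ _ → 1ℤ) ≡ total)
      (∑-χ-vertices : ∀ a → ∑ (vertices n) (λ x → χ x a) ≡ star)
      (∑-χχ-vertices : ∀ a b → ∑ (vertices n) (λ x → χ x a * χ x b) ≡ m + ind (does (a Fin.≟ b)) * (star - m))
      where

      ∑ℓ : ∑ V ℓ ≡ star * (+ 3 * ∑f)
      ∑ℓ = begin
        ∑ V ℓ                               ≡⟨ ∑-comm V I _ ⟩
        ∑ I (λ a → ∑ V (λ x → χ x a * g a))
          ≡⟨ ∑-cong I (λ {a} _ → trans (∑-*ʳ V (g a) _) (cong (_* g a) (∑-χ-vertices a))) ⟩
        ∑ I (λ a → star * g a)              ≡⟨ ∑-*ˡ I star g ⟩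
        star * ∑ I g                        ≡⟨ cong (star *_) ∑g≡3∑f ⟩
        star * (+ 3 * ∑f)                   ∎

      -- The Gram expansion with points as coordinates: the matrix is that of the stars, so the
      -- J-part gives m (Σ g)² and the identity part gives (M - m) Σ g².
      ∑ℓ² : ∑ V (λ x → ℓ x * ℓ x) ≡ m * ((+ 3 * ∑f) * (+ 3 * ∑f)) + (star - m) * ∑g²
      ∑ℓ² = begin
        ∑ V (λ x → ℓ x * ℓ x)
          ≡⟨ ∑-gram V I (λ a x → χ x a) g ⟩
        ∑ I (λ a → ∑ I (λ b → ∑ V (λ x → χ x a * χ x b) * (g a * g b)))
          ≡⟨ ∑-cong I (λ {a} _ → ∑-cong I λ {b} _ → trans (cong (_* (g a * g b)) (∑-χχ-vertices a b))
               (split m star (ind (does (a Fin.≟ b))) (g a * g b))) ⟩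
        ∑ I (λ a → ∑ I (λ b → m * (g a * g b) + ((star - m) * (ind (does (a Fin.≟ b)) * (g a * g b)) + 0ℤ)))
          ≡⟨ ∑∑-lc I I ((m , λ a b → g a * g b) ∷ (star - m , λ a b → ind (does (a Fin.≟ b)) * (g a * g b)) ∷ []) ⟩
        m * ∑ I (λ a → ∑ I (λ b → g a * g b)) + ((star - m) * ∑ I (λ a → ∑ I (λ b → ind (does (a Fin.≟ b)) * (g a * g b))) + 0ℤ)
          ≡⟨ cong₂ (λ i j → m * i + j) ∑∑gg (trans (+-identityʳ _) (cong ((star - m) *_) (∑-cong I λ {a} a∈ → ∑-δ Fin._≟_ (λ b → g a * g b) (allFin⁺ n) a∈))) ⟩
        _ ∎
        where
        split : ∀ m M e q → (m + e * (M - m)) * q ≡ m * q + ((M - m) * (e * q) + 0ℤ)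
        split = solve-∀

      module _ (p q : ℤ) where

        -- For p = (n - 1)(n - 2)(n - 3) and q = - 2 (n - 1) the values of t sum to 0 over every
        -- star. This orthogonality to the stars determines the coefficients, including the 12.
        t : Subset n → ℤ
        t x = p * f x + q * ℓ x + + 12 * ∑f

        ∑t² : ∑ V (λ x → t x * t x) ≡ t²-form p q m star total ∑f ∑f² ∑g²
        ∑t² = begin
          ∑ V (λ x → t x * t x)
            ≡⟨ ∑-cong V (λ {x} _ → expand p q (f x) (ℓ x) ∑f) ⟩
          ∑ V (λ x → lc (map (λ (k , φ) → k , φ x) terms))
            ≡⟨ ∑-lc V terms ⟩
          lc (map (λ (k , φ) → k , ∑ V φ) terms)
            ≡⟨ collect ∑fℓ ∑ℓ² ∑ℓ ∑1 ⟩
          t²-form p q m star total ∑f ∑f² ∑g² ∎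
          where
          terms : List (ℤ × (Subset n → ℤ))
          terms = (p * p , λ x → f x * f x) ∷ (+ 2 * (p * q) , λ x → f x * ℓ x) ∷ (+ 24 * (p * ∑f) , f) ∷ (q * q , λ x → ℓ x * ℓ x)
                ∷ (+ 24 * (q * ∑f) , ℓ) ∷ (+ 144 * (∑f * ∑f) , λ _ → 1ℤ) ∷ []
          expand : ∀ p q f ℓ F → (p * f + q * ℓ + + 12 * F) * (p * f + q * ℓ + + 12 * F) ≡
            p * p * (f * f) + (+ 2 * (p * q) * (f * ℓ) + (+ 24 * (p * F) * f + (q * q * (ℓ * ℓ) + (+ 24 * (q * F) * ℓ + (+ 144 * (F * F) * 1ℤ + 0ℤ)))))
          expand = solve-∀
          collect : ∀ {c₁ c₂ c₃ c₄} → c₁ ≡ ∑g² → c₂ ≡ m * ((+ 3 * ∑f) * (+ 3 * ∑f)) + (star - m) * ∑g² → c₃ ≡ star * (+ 3 * ∑f) → c₄ ≡ total →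
            p * p * ∑f² + (+ 2 * (p * q) * c₁ + (+ 24 * (p * ∑f) * ∑f + (q * q * c₂ + (+ 24 * (q * ∑f) * c₃ + (+ 144 * (∑f * ∑f) * c₄ + 0ℤ))))) ≡ t²-form p q m star total ∑f ∑f² ∑g²
          collect refl refl refl refl = eq p q m star total ∑f ∑f² ∑g²
            where
            eq : ∀ p q m M N F E G →
              p * p * E + (+ 2 * (p * q) * G + (+ 24 * (p * F) * F + (q * q * (m * ((+ 3 * F) * (+ 3 * F)) + (M - m) * G) + (+ 24 * (q * F) * (M * (+ 3 * F)) + (+ 144 * (F * F) * N + 0ℤ)))))
              ≡ p * p * E + + 2 * p * q * G + + 24 * p * (F * F) + q * q * (m * (+ 9 * (F * F)))
                + q * q * (M - m) * G + + 72 * q * M * (F * F) + + 144 * N * (F * F)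
            eq = solve-∀

  *-nonneg : ∀ {i j} → 0ℤ ≤ i → 0ℤ ≤ j → 0ℤ ≤ i * j
  *-nonneg {i} {j} 0≤i 0≤j = subst (_≤ i * j) (*-zeroʳ i) (*-monoˡ-≤-nonNeg i {{nonNegative 0≤i}} 0≤j)

  module _ {n} (f : Subset n → ℤ) (k M N μ : ℤ)
    (n≡k+3 : + n ≡ k + + 3)
    (∑1≡N : ∑ (vertices n) (λ _ → 1ℤ) ≡ N)
    (∑χ≡M : ∀ a → ∑ (vertices n) (λ x → χ x a) ≡ M)
    (∑χχ : ∀ a b → ∑ (vertices n) (λ x → χ x a * χ x b) ≡ k + + 1 + ind (does (a Fin.≟ b)) * (M - (k + + 1)))
    (2M≡P : + 2 * M ≡ (k + + 2) * (k + + 1))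
    (6N≡nP : + 6 * N ≡ (k + + 3) * ((k + + 2) * (k + + 1)))
    (2μ≡μ₂ : + 2 * μ ≡ (k - + 1) * (k - + 2))
    (0≤P : 0ℤ ≤ (k + + 2) * (k + + 1))
    (0≤μ₂-2 : 0ℤ ≤ (k - + 1) * (k - + 2) - + 2)
    (D*D>0 : Positive ((k + + 2) * (k + + 1) * k * ((k + + 2) * (k + + 1) * k)))
    where
    open Weights f
    open Squares f

    private
      P Q D μ₂ W : ℤ
      P = (k + + 2) * (k + + 1)
      Q = - + 2 * (k + + 2)
      D = P * k
      μ₂ = (k - + 1) * (k - + 2)
      W = ∑f * ∑f

      R Δ T X : ℤ
      R = ∑ I (λ a → ∑ I (λ b → r P Q a b * r P Q a b))
      Δ = ∑ I (λ a → r P Q a a * r P Q a a)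
      T = ∑ V (λ x → t (k + + 1) ∑1≡N ∑χ≡M ∑χχ D Q x * t (k + + 1) ∑1≡N ∑χ≡M ∑χχ D Q x)
      X = M * (disjointPairs + μ * ∑f²) - μ * W

      R≡ : R ≡ r²-form P Q (k + + 3) ∑f ∑g² ∑h²
      R≡ = trans (∑∑r² P Q) (cong (λ n → r²-form P Q n ∑f ∑g² ∑h²) n≡k+3)

      Δ≡ : Δ ≡ diagonal-form P Q (k + + 3) ∑f ∑g² ∑h²
      Δ≡ = trans (∑r²-diagonal P Q) (cong (λ n → diagonal-form P Q n ∑f ∑g² ∑h²) n≡k+3)

      T≡ : T ≡ t²-form D Q (k + + 1) M N ∑f ∑f² ∑g²
      T≡ = ∑t² (k + + 1) ∑1≡N ∑χ≡M ∑χχ D Q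

      tform : ℤ → ℤ → ℤ
      tform S U = D * D * ∑f² + + 2 * D * Q * ∑g² + + 24 * D * W + Q * Q * ((k + + 1) * (+ 9 * W))
        + + 2 * ((k + + 2) * (k + + 2)) * (S - + 2 * (k + + 1)) * ∑g² + + 36 * Q * S * W + + 24 * U * W

      -- D² absorbs the scaling of the squares. The 4 supplies one factor 2 for `disjointPairs` or μ
      -- and another for M, whose closed forms are all known only after doubling.
      certificate : D * D * (+ 4 * X) ≡ P * (k * k * (R - Δ) + (μ₂ - + 2) * T)
      certificate = begin
        D * D * (+ 4 * X)
          ≡⟨ cong (D * D *_) (double M μ disjointPairs ∑f² W) ⟩
        D * D * (+ 2 * M * (+ 2 * disjointPairs) + + 2 * M * (+ 2 * μ) * ∑f² - + 2 * (+ 2 * μ) * W)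
          ≡⟨ cong₂ (λ S u → D * D * (S * (+ 2 * disjointPairs) + S * u * ∑f² - + 2 * u * W)) 2M≡P 2μ≡μ₂ ⟩
        D * D * (P * (+ 2 * disjointPairs) + P * μ₂ * ∑f² - + 2 * μ₂ * W)
          ≡⟨ cong (λ d → D * D * (P * d + P * μ₂ * ∑f² - + 2 * μ₂ * W)) 2disjointPairs ⟩
        D * D * (P * (+ 2 * W - + 3 * ∑g² + ∑h² - + 2 * ∑f²) + P * μ₂ * ∑f² - + 2 * μ₂ * W)
          ≡⟨ sum-of-squares k ∑f ∑g² ∑h² ∑f² ⟩
        P * (k * k * (r²-form P Q (k + + 3) ∑f ∑g² ∑h² - diagonal-form P Q (k + + 3) ∑f ∑g² ∑h²)
          + (μ₂ - + 2) * tform P ((k + + 3) * P))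
          ≡⟨ cong₂ (λ S U → P * (k * k * (r²-form P Q (k + + 3) ∑f ∑g² ∑h² - diagonal-form P Q (k + + 3) ∑f ∑g² ∑h²)
               + (μ₂ - + 2) * tform S U)) 2M≡P 6N≡nP ⟨
        P * (k * k * (r²-form P Q (k + + 3) ∑f ∑g² ∑h² - diagonal-form P Q (k + + 3) ∑f ∑g² ∑h²)
          + (μ₂ - + 2) * tform (+ 2 * M) (+ 6 * N))
          ≡⟨ cong₂ (λ d e → P * (k * k * d + (μ₂ - + 2) * e)) (cong₂ _-_ R≡ Δ≡) (trans T≡ (double-counts k M N ∑f ∑g² ∑f²)) ⟨
        P * (k * k * (R - Δ) + (μ₂ - + 2) * T) ∎
        where
        double : ∀ M μ d E W → + 4 * (M * (d + μ * E) - μ * W) ≡ + 2 * M * (+ 2 * d) + + 2 * M * (+ 2 * μ) * E - + 2 * (+ 2 * μ) * W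
        double = solve-∀

    -- X is the difference of the two sides, and the certificate makes a positive multiple of it
    -- nonnegative: R - Δ is the off-diagonal part of a sum of squares, and T is a sum of squares
    -- with coefficient μ₂ - 2 ≥ 0.
    hoffman-ℤ : μ * (∑f * ∑f) ≤ M * (disjointPairs + μ * ∑f²)
    hoffman-ℤ = 0≤i-j⇒j≤i (*-cancelˡ-≤-pos 0ℤ X (+ 4) (*-cancelˡ-≤-pos 0ℤ (+ 4 * X) (D * D) {{D*D>0}}
      (subst₂ _≤_ (sym (*-zeroʳ (D * D))) (sym certificate)
        (*-nonneg 0≤P
          (+-mono-≤ (*-nonneg (square≥0 k) (i≤j⇒0≤j-i (∑∑-diagonal≤ I (r P Q))))
                    (*-nonneg 0≤μ₂-2 (∑-nonneg V λ x → square≥0 (t (k + + 1) ∑1≡N ∑χ≡M ∑χχ D Q x))))))))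

  module _ (j : ℕ) (f : Subset (6 ℕ.+ j) → ℤ) where
    open Weights f

    private
      k P D μ₂ M N μ : ℤ
      k = + (3 ℕ.+ j)
      P = (k + + 2) * (k + + 1)
      D = P * k
      μ₂ = (k - + 1) * (k - + 2)
      M = + ((5 ℕ.+ j) C 2)
      N = + ((6 ℕ.+ j) C 3)
      μ = + ((2 ℕ.+ j) C 2)

      k+ : ∀ i → + (i ℕ.+ (3 ℕ.+ j)) ≡ k + + i
      k+ i = cong +_ (ℕ.+-comm i (3 ℕ.+ j))

      2M≡P : + 2 * M ≡ P
      2M≡P = begin
        + 2 * M                         ≡⟨ pos-* 2 ((5 ℕ.+ j) C 2) ⟨
        + (2 ℕ.* ((5 ℕ.+ j) C 2))       ≡⟨ cong +_ (2*C2 (4 ℕ.+ j)) ⟩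
        + ((5 ℕ.+ j) ℕ.* (4 ℕ.+ j))     ≡⟨ pos-* (5 ℕ.+ j) (4 ℕ.+ j) ⟩
        + (5 ℕ.+ j) * + (4 ℕ.+ j)       ≡⟨ cong₂ _*_ (k+ 2) (k+ 1) ⟩
        P                               ∎

      6N≡nP : + 6 * N ≡ (k + + 3) * P
      6N≡nP = begin
        + 6 * N                                           ≡⟨ pos-* 6 ((6 ℕ.+ j) C 3) ⟨
        + (6 ℕ.* ((6 ℕ.+ j) C 3))                         ≡⟨ cong +_ (6*C3 (4 ℕ.+ j)) ⟩
        + ((6 ℕ.+ j) ℕ.* (5 ℕ.+ j) ℕ.* (4 ℕ.+ j))         ≡⟨ pos-* ((6 ℕ.+ j) ℕ.* (5 ℕ.+ j)) (4 ℕ.+ j) ⟩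
        + ((6 ℕ.+ j) ℕ.* (5 ℕ.+ j)) * + (4 ℕ.+ j)         ≡⟨ cong (_* + (4 ℕ.+ j)) (pos-* (6 ℕ.+ j) (5 ℕ.+ j)) ⟩
        + (6 ℕ.+ j) * + (5 ℕ.+ j) * + (4 ℕ.+ j)           ≡⟨ *-assoc (+ (6 ℕ.+ j)) (+ (5 ℕ.+ j)) (+ (4 ℕ.+ j)) ⟩
        + (6 ℕ.+ j) * (+ (5 ℕ.+ j) * + (4 ℕ.+ j))         ≡⟨ cong₂ _*_ (k+ 3) (cong₂ _*_ (k+ 2) (k+ 1)) ⟩
        (k + + 3) * P                                     ∎

      2μ≡μ₂ : + 2 * μ ≡ μ₂
      2μ≡μ₂ = trans (sym (pos-* 2 ((2 ℕ.+ j) C 2))) (trans (cong +_ (2*C2 (1 ℕ.+ j))) (pos-* (2 ℕ.+ j) (1 ℕ.+ j)))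

      -- The quantity is 2 (μ - 1), and μ = C(n-4,2) is at least 1 because n = 6 + j.
      0≤μ₂-2 : 0ℤ ≤ μ₂ - + 2
      0≤μ₂-2 = i≤j⇒0≤j-i (subst (+ 2 ≤_) (pos-* (2 ℕ.+ j) (1 ℕ.+ j)) (+≤+ (ℕ.*-mono-≤ {2} {2 ℕ.+ j} {1} {1 ℕ.+ j} (ℕ.m≤m+n 2 j) (ℕ.m≤m+n 1 j))))

      P≡ : P ≡ + ((5 ℕ.+ j) ℕ.* (4 ℕ.+ j))
      P≡ = sym (trans (pos-* (5 ℕ.+ j) (4 ℕ.+ j)) (cong₂ _*_ (k+ 2) (k+ 1)))

      D≡ : D ≡ + ((5 ℕ.+ j) ℕ.* (4 ℕ.+ j) ℕ.* (3 ℕ.+ j))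
      D≡ = trans (cong (_* k) P≡) (sym (pos-* ((5 ℕ.+ j) ℕ.* (4 ℕ.+ j)) (3 ℕ.+ j)))

      D*D>0 : Positive (D * D)
      D*D>0 = subst (λ d → Positive (d * d)) (sym D≡) _

    hoffman-6+j : μ * (∑f * ∑f) ≤ M * (disjointPairs + μ * ∑f²)
    hoffman-6+j = hoffman-ℤ f k M N μ (k+ 3) (∑1≡total (4 ℕ.+ j)) (∑-χ-vertices (4 ℕ.+ j))
      (λ a b → trans (∑-χχ-vertices (4 ℕ.+ j) a b) (cong (λ m → m + ind (does (a Fin.≟ b)) * (M - m)) (k+ 1)))
      2M≡P 6N≡nP 2μ≡μ₂ (subst (0ℤ ≤_) (sym P≡) (+≤+ ℕ.z≤n)) 0≤μ₂-2 D*D>0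

-- From the Hoffman inequality to cuts.

module CutBound where
  import Data.Integer as ℤ
  import Data.Integer.Properties as ℤ
  open import Data.Nat
  open import Data.Nat.Combinatorics using (_C_; nCk+nC[k+1]≡[n+1]C[k+1])
  open import Data.Nat.Divisibility using (_∣_; ∣-trans; m≤n⇒m!∣n!; ∣m⇒∣m*n; ∣-refl)
  open import Data.Nat.Properties
  open import Data.Nat.Tactic.RingSolver using (solve-∀)
  open Counting
  open HoffmanBound using (pos-ind; pos-∑; hoffman-6+j)
  open Sums +-*-commutativeSemiring

  private
    variable
      X : Set

  ∑-mono : ∀ (xs : List X) {φ ψ} → (∀ {x} → x ∈ xs → φ x ≤ ψ x) → ∑ xs φ ≤ ∑ xs ψ
  ∑-mono []       φ≤ψ = z≤n
  ∑-mono (x ∷ xs) φ≤ψ = +-mono-≤ (φ≤ψ (here refl)) (∑-mono xs (φ≤ψ ∘ there))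

  ∑-mono-< : ∀ {xs : List X} {φ ψ x} → (∀ {x} → x ∈ xs → φ x ≤ ψ x) → x ∈ xs → φ x < ψ x → ∑ xs φ < ∑ xs ψ
  ∑-mono-< {xs = x ∷ xs} φ≤ψ (here refl) φx<ψx = +-mono-<-≤ φx<ψx (∑-mono xs (φ≤ψ ∘ there))
  ∑-mono-< {xs = x ∷ xs} φ≤ψ (there x∈)  φx<ψx = +-mono-≤-< (φ≤ψ (here refl)) (∑-mono-< (φ≤ψ ∘ there) x∈ φx<ψx)

  ∑-const : ∀ (xs : List X) k → ∑ xs (λ _ → k) ≡ length xs * k
  ∑-const []       k = refl
  ∑-const (x ∷ xs) k = cong (k +_) (∑-const xs k)

  ∑-const-Fin : ∀ c k → ∑ (allFin c) (λ _ → k) ≡ c * k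
  ∑-const-Fin c k = trans (∑-const (allFin c) k) (cong (_* k) (length-tabulate {n = c} (λ i → i)))

  hoffman-6+ : ∀ j (f : Subset (6 + j) → ℕ) → let V = vertices (6 + j); μ = (2 + j) C 2 in
    μ * (∑ V f * ∑ V f) ≤
    ((5 + j) C 2) * (∑ V (λ x → ∑ V (λ y → ind (disjoint? x y) * (f x * f y))) + μ * ∑ V (λ x → f x * f x))
  hoffman-6+ j f = ℤ.drop‿+≤+ (subst₂ ℤ._≤_ (sym lhs) (sym rhs) (hoffman-6+j j (λ x → ℤ.+ f x)))
    where
    open ≡-Reasoning
    module ℤ∑ = Sums ℤ.+-*-commutativeSemiring
    V = vertices (6 + j)
    μ = (2 + j) C 2
    M = (5 + j) C 2
    pairs = ∑ V (λ x → ∑ V (λ y → ind (disjoint? x y) * (f x * f y)))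
    lhs : ℤ.+ (μ * (∑ V f * ∑ V f)) ≡ ℤ.+ μ ℤ.* (ℤ∑.∑ V (λ x → ℤ.+ f x) ℤ.* ℤ∑.∑ V (λ x → ℤ.+ f x))
    lhs = trans (ℤ.pos-* μ (∑ V f * ∑ V f))
      (cong (ℤ.+ μ ℤ.*_) (trans (ℤ.pos-* (∑ V f) (∑ V f)) (cong₂ ℤ._*_ (pos-∑ V f) (pos-∑ V f))))
    pos-pairs : ℤ.+ pairs ≡ ℤ∑.∑ V (λ x → ℤ∑.∑ V (λ y → ℤ∑.ind (disjoint? x y) ℤ.* (ℤ.+ f x ℤ.* ℤ.+ f y)))
    pos-pairs = trans (pos-∑ V _) (ℤ∑.∑-cong V λ {x} _ → trans (pos-∑ V _) (ℤ∑.∑-cong V λ {y} _ →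
      trans (ℤ.pos-* (ind (disjoint? x y)) (f x * f y)) (cong₂ ℤ._*_ (pos-ind (disjoint? x y)) (ℤ.pos-* (f x) (f y)))))
    rhs : ℤ.+ (M * (pairs + μ * ∑ V (λ x → f x * f x))) ≡
          ℤ.+ M ℤ.* (ℤ∑.∑ V (λ x → ℤ∑.∑ V (λ y → ℤ∑.ind (disjoint? x y) ℤ.* (ℤ.+ f x ℤ.* ℤ.+ f y)))
            ℤ.+ ℤ.+ μ ℤ.* ℤ∑.∑ V (λ x → ℤ.+ f x ℤ.* ℤ.+ f x))
    rhs = trans (ℤ.pos-* M _) (cong (ℤ.+ M ℤ.*_) (trans (ℤ.pos-+ pairs _) (cong₂ ℤ._+_ pos-pairs
      (trans (ℤ.pos-* μ _) (cong (ℤ.+ μ ℤ.*_) (trans (pos-∑ V _) (ℤ∑.∑-cong V λ {x} _ → ℤ.pos-* (f x) (f x))))))))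

  hoffman : ∀ {n} → 6 ≤ n → (f : Subset n → ℕ) → let V = vertices n; μ = (n ∸ 4) C 2 in
    μ * (∑ V f * ∑ V f) ≤
    ((n ∸ 1) C 2) * (∑ V (λ x → ∑ V (λ y → ind (disjoint? x y) * (f x * f y))) + μ * ∑ V (λ x → f x * f x))
  hoffman 6≤n f with m≤n⇒∃[o]m+o≡n 6≤n
  ... | j , refl = hoffman-6+ j f

  C2≢0 : ∀ {k} → 2 ≤ k → NonZero (k C 2)
  C2≢0 {suc (suc k)} (s≤s (s≤s z≤n)) = m*n≢0⇒n≢0 2 {{subst NonZero (sym (2*C2 (suc k))) _}}

  -- `local x` is the share of x in the quadratic form. A bound proportional to f x on every share
  -- turns the quadratic inequality into a linear one for Σ f.
  module LocalBound {n} (6≤n : 6 ≤ n) (f : Subset n → ℕ) (B : ℕ) where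
    V : List (Subset n)
    V = vertices n

    M μ : ℕ
    M = (n ∸ 1) C 2
    μ = (n ∸ 4) C 2

    local : Subset n → ℕ
    local x = ∑ V (λ y → ind (disjoint? x y) * (f x * f y)) + μ * (f x * f x)

    private
      F : ℕ
      F = ∑ V f

      instance
        μ≢0 : NonZero μ
        μ≢0 = C2≢0 (∸-monoˡ-≤ 4 6≤n)

        M≢0 : NonZero M
        M≢0 = C2≢0 (≤-trans (s≤s (s≤s z≤n)) (∸-monoˡ-≤ 1 6≤n))

      quadratic : μ * (F * F) ≤ M * ∑ V local
      quadratic = subst (λ t → μ * (F * F) ≤ M * t)
        (sym (trans (∑-+ V _ _) (cong (∑ V (λ x → ∑ V (λ y → ind (disjoint? x y) * (f x * f y))) +_) (∑-*ˡ V μ _)))) (hoffman 6≤n f)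

      ∑-bound : ∑ V (λ x → B * μ * f x) ≡ B * μ * F
      ∑-bound = ∑-*ˡ V (B * μ) f

      rearrange : ∀ M B μ F → M * (B * μ * F) ≡ μ * F * (M * B)
      rearrange = solve-∀

    -- Summing the shares gives μ F² ≤ M B μ F, and μ F cancels unless F = 0.
    weight≤ : (∀ {x} → x ∈ V → local x ≤ B * μ * f x) → F ≤ M * B
    weight≤ bound with F ≟ 0
    ... | yes F≡0 = subst (_≤ M * B) (sym F≡0) z≤n
    ... | no  F≢0 = *-cancelˡ-≤ (μ * F) {{m*n≢0 μ F {{it}} {{≢-nonZero F≢0}}}} (begin
      μ * F * F         ≡⟨ *-assoc μ F F ⟩
      μ * (F * F)       ≤⟨ quadratic ⟩
      M * ∑ V local     ≤⟨ *-monoʳ-≤ M (∑-mono V bound) ⟩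
      M * ∑ V (λ x → B * μ * f x) ≡⟨ cong (M *_) ∑-bound ⟩
      M * (B * μ * F)   ≡⟨ rearrange M B μ F ⟩
      μ * F * (M * B)   ∎)
      where open ≤-Reasoning

    -- One strict share makes the sum strict, as M is nonzero. The case F = 0 is not split off,
    -- since a strict inequality between two products with a common factor cancels it
    -- unconditionally.
    weight< : (∀ {x} → x ∈ V → local x ≤ B * μ * f x) → ∀ {x} → x ∈ V → local x < B * μ * f x → F < M * B
    weight< bound x∈ loc< = *-cancelˡ-< (μ * F) F (M * B) (begin-strict
      μ * F * F         ≡⟨ *-assoc μ F F ⟩
      μ * (F * F)       ≤⟨ quadratic ⟩
      M * ∑ V local     <⟨ *-monoʳ-< M (∑-mono-< bound x∈ loc<) ⟩
      M * ∑ V (λ x → B * μ * f x) ≡⟨ cong (M *_) ∑-bound ⟩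
      M * (B * μ * F)   ≡⟨ rearrange M B μ F ⟩
      μ * F * (M * B)   ∎)
      where open ≤-Reasoning

  disjoint?⇒Adj : ∀ {n} (x y : Subset n) → disjoint? x y ≡ true → Adj n x y
  disjoint?⇒Adj x y eq = ∣x∩y∣≡0⇒Adj {x = x} {y} (≡ᵇ⇒≡ ∣ x ∩ y ∣ 0 (subst Bool.T (sym eq) _))

  disjoint?-irrefl : ∀ {n} {x : Subset n} → ∣ x ∣ ≡ 3 → disjoint? x x ≡ false
  disjoint?-irrefl {x = x} ∣x∣ = cong (_≡ᵇ 0) (trans (cong ∣_∣ (∩-idem x)) ∣x∣)

  -- The Erdős-Ko-Rado bound for triples. For the indicator of J no adjacent pair contributes, so
  -- the share of x is μ times its weight and the local bound holds with B = 1.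
  independent≤star : ∀ {n} → 6 ≤ n → ∀ J → Independent n 3 J → card n 3 J ≤ (n ∸ 1) C 2
  independent≤star {n} 6≤n J ind-J = begin
    card n 3 J       ≡⟨ card≡∑ n J ⟩
    ∑ V (ind ∘ J)    ≤⟨ weight≤ bound ⟩
    M * 1            ≡⟨ *-identityʳ M ⟩
    M                ∎
    where
    open LocalBound 6≤n (ind ∘ J) 1
    open ≤-Reasoning
    no-edge : ∀ {x y} → x ∈ V → y ∈ V → ind (disjoint? x y) * (ind (J x) * ind (J y)) ≡ 0
    no-edge {x} {y} x∈ y∈ with disjoint? x y in d | J x in Jx | J y in Jy
    ... | false | _     | _     = refl
    ... | true  | false | _     = refl
    ... | true  | true  | false = refl
    ... | true  | true  | true  = contradiction (disjoint?⇒Adj x y d) (ind-J x y (∈-vertices⁻ x∈) (∈-vertices⁻ y∈) Jx Jy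
        λ { refl → contradiction (trans (sym d) (disjoint?-irrefl {x = x} (∈-vertices⁻ x∈))) λ () })
    bound : ∀ {x} → x ∈ V → local x ≤ 1 * μ * ind (J x)
    bound {x} x∈ = ≤-reflexive (trans (cong (_+ μ * (ind (J x) * ind (J x))) (trans (∑-cong V (no-edge x∈)) (∑-0 V)))
      (idem (J x)))
      where
      idem : ∀ b → μ * (ind b * ind b) ≡ 1 * μ * ind b
      idem true  = cong (_* 1) (sym (*-identityˡ μ))
      idem false = trans (*-zeroʳ μ) (sym (*-zeroʳ (1 * μ)))

  -- Arithmetic of the local bound for n ≥ 9.

  module DegreeBound-9+ (m : ℕ) where
    n d q μ : ℕ
    n = 9 + m
    d = (6 + m) C 3
    q = (4 + m) C 3
    μ = (5 + m) C 2

    [n-3]μ≡3d : (6 + m) * μ ≡ 3 * d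
    [n-3]μ≡3d = sym (3*C3 (3 + m))

    -- The source of the condition n ≥ 9: C(n-5,3) is 4 for n = 9 but only 1 for n = 8. After
    -- doubling, the difference of the two sides is a polynomial in m = n - 9 with positive
    -- coefficients.
    n<3q : n < 3 * q
    n<3q = *-cancelˡ-< 2 n (3 * q) (begin-strict
      2 * n                                             <⟨ m<m+n (2 * n) z<s ⟩
      2 * n + suc (5 + 24 * m + 9 * (m * m) + m * m * m) ≡⟨ arith m ⟩
      (4 + m) * (3 + m) * (2 + m)                       ≡⟨ 6*C3 (2 + m) ⟨
      6 * q                                             ≡⟨ *-assoc 2 3 q ⟩
      2 * (3 * q)                                       ∎)
      where
      open ≤-Reasoning
      arith : ∀ m → 2 * (9 + m) + suc (5 + 24 * m + 9 * (m * m) + m * m * m) ≡ (4 + m) * (3 + m) * (2 + m)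
      arith = solve-∀

    instance
      d≢0 : NonZero d
      d≢0 = m*n≢0⇒n≢0 6 {{subst NonZero (sym (6*C3 (4 + m))) _}}

    -- The first bound on the degree settles 3u + n < 3d, the second one the other case.
    degree-core : ∀ {u δ} → 0 < u → δ ≤ u → δ + q ≤ d → (3 * u + n) * δ < 3 * u * d
    degree-core {u} {δ} 0<u δ≤u δ+q≤d with 3 * d ≤? 3 * u + n
    ... | no ¬3d≤ = begin-strict
      (3 * u + n) * δ  ≤⟨ *-monoʳ-≤ (3 * u + n) δ≤u ⟩
      (3 * u + n) * u  <⟨ *-monoˡ-< u {{>-nonZero 0<u}} (≰⇒> ¬3d≤) ⟩
      3 * d * u        ≡⟨ arith d u ⟩
      3 * u * d        ∎
      where
      open ≤-Reasoning
      arith : ∀ d u → 3 * d * u ≡ 3 * u * d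
      arith = solve-∀
    ... | yes 3d≤ = +-cancelʳ-< ((3 * u + n) * q) ((3 * u + n) * δ) (3 * u * d) (begin-strict
      (3 * u + n) * δ + (3 * u + n) * q  ≡⟨ *-distribˡ-+ (3 * u + n) δ q ⟨
      (3 * u + n) * (δ + q)              ≤⟨ *-monoʳ-≤ (3 * u + n) δ+q≤d ⟩
      (3 * u + n) * d                    ≡⟨ *-distribʳ-+ d (3 * u) n ⟩
      3 * u * d + n * d                  <⟨ +-monoʳ-< (3 * u * d) (*-monoˡ-< d n<3q) ⟩
      3 * u * d + 3 * q * d              ≡⟨ cong (3 * u * d +_) (arith q d) ⟩
      3 * u * d + 3 * d * q              ≤⟨ +-monoʳ-≤ (3 * u * d) (*-monoˡ-≤ q 3d≤) ⟩
      3 * u * d + (3 * u + n) * q        ∎)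
      where
      open ≤-Reasoning
      arith : ∀ q d → 3 * q * d ≡ 3 * d * q
      arith = solve-∀

    -- The local bound for the weight (3 u + n) / s, multiplied by s = u + 1. The terms in μ differ
    -- by u (n - 3) μ = 3 u d, which leaves exactly `degree-core`.
    degree-bound< : ∀ {u δ} → 0 < u → δ ≤ u → δ + q ≤ d → (3 * u + n) * (δ + μ) < n * suc u * μ
    degree-bound< {u} {δ} 0<u δ≤u δ+q≤d = begin-strict
      (3 * u + n) * (δ + μ)                     ≡⟨ *-distribˡ-+ (3 * u + n) δ μ ⟩
      (3 * u + n) * δ + (3 * u + n) * μ         <⟨ +-monoˡ-< ((3 * u + n) * μ) (degree-core 0<u δ≤u δ+q≤d) ⟩
      3 * u * d + (3 * u + n) * μ               ≡⟨ cong (_+ (3 * u + n) * μ) (arith₁ u d) ⟩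
      u * (3 * d) + (3 * u + n) * μ             ≡⟨ cong (λ t → u * t + (3 * u + n) * μ) [n-3]μ≡3d ⟨
      u * ((6 + m) * μ) + (3 * u + n) * μ       ≡⟨ arith₂ u m μ ⟩
      n * suc u * μ                             ∎
      where
      open ≤-Reasoning
      arith₁ : ∀ u d → 3 * u * d ≡ u * (3 * d)
      arith₁ = solve-∀
      arith₂ : ∀ u m μ → u * ((6 + m) * μ) + (3 * u + (9 + m)) * μ ≡ (9 + m) * suc u * μ
      arith₂ = solve-∀

  module DegreeBound {n : ℕ} (9≤n : 9 ≤ n) where
    d q μ : ℕ
    d = (n ∸ 3) C 3
    q = (n ∸ 5) C 3
    μ = (n ∸ 4) C 2

    degree-bound< : ∀ {u δ} → 0 < u → δ ≤ u → δ + q ≤ d → (3 * u + n) * (δ + μ) < n * suc u * μ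
    degree-bound< with m≤n⇒∃[o]m+o≡n 9≤n
    ... | m , refl = DegreeBound-9+.degree-bound< m

    degree-bound≤ : ∀ {u δ} → δ ≤ u → δ + q ≤ d → (3 * u + n) * (δ + μ) ≤ n * suc u * μ
    -- A single vertex has no remaining neighbour, and both sides equal n μ; equality in the
    -- toughness bound lives here.
    degree-bound≤ {zero}  z≤n  _     = ≤-reflexive (cong (_* μ) (sym (*-identityʳ n)))
    degree-bound≤ {suc u} δ≤u  δ+q≤d = <⇒≤ (degree-bound< z<s δ≤u δ+q≤d)

  -- Weights on the components of a cut.

  m∣n! : ∀ {m n} → 0 < m → m ≤ n → m ∣ n !
  m∣n! {suc m} _ m≤n = ∣-trans (∣m⇒∣m*n (m !) ∣-refl) (m≤n⇒m!∣n! m≤n)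

  another : ∀ {c} → 2 ≤ c → (i : Fin c) → ∃[ i′ ] i ≢ i′
  another (s≤s (s≤s _)) zero    = suc zero , λ ()
  another (s≤s (s≤s _)) (suc i) = zero , λ ()

  -- Components are given by a labelling: an edge between remaining vertices preserves the label,
  -- and every label occurs on a remaining vertex. `label` is total on subsets so that it can be
  -- used inside sums over `V`; every use is guarded by `alive`.
  module Cut {n} (9≤n : 9 ≤ n) (c : ℕ) (alive : Subset n → Bool) (label : Subset n → Fin c)
    (edge⇒label≡ : ∀ {x y} → ∣ x ∣ ≡ 3 → ∣ y ∣ ≡ 3 → alive x ≡ true → alive y ≡ true →
                   disjoint? x y ≡ true → label x ≡ label y)
    (representative : ∀ i → ∃[ x ] (∣ x ∣ ≡ 3 × alive x ≡ true × label x ≡ i))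
    (2≤c : 2 ≤ c)
    where
    open DegreeBound 9≤n

    6≤n : 6 ≤ n
    6≤n = ≤-trans (m≤m+n 6 3) 9≤n

    V : List (Subset n)
    V = vertices n

    I : List (Fin c)
    I = allFin c

    inClass : Fin c → Subset n → Bool
    inClass i y = alive y ∧ does (label y Fin.≟ i)

    size : Fin c → ℕ
    size i = ∑ V (ind ∘ inClass i)

    inClass-label : ∀ x → alive x ≡ true → inClass (label x) x ≡ true
    inClass-label x ax with alive x | label x Fin.≟ label x
    ... | true | yes _ = refl
    ... | true | no l≢l = contradiction refl l≢l

    ∑-partition : ∀ φ → ∑ V (λ x → ind (alive x) * φ (label x)) ≡ ∑ I (λ i → size i * φ i)
    ∑-partition φ = begin
      ∑ V (λ x → ind (alive x) * φ (label x))
        ≡⟨ ∑-cong V (λ {x} _ → cong (ind (alive x) *_) (∑-δ Fin._≟_ φ (allFin⁺ c) (∈-allFin (label x)))) ⟨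
      ∑ V (λ x → ind (alive x) * ∑ I (λ i → ind (does (label x Fin.≟ i)) * φ i))
        ≡⟨ ∑-cong V (λ {x} _ → trans (sym (∑-*ˡ I (ind (alive x)) _)) (∑-cong I λ {i} _ →
             trans (sym (*-assoc (ind (alive x)) _ (φ i))) (cong (_* φ i) (sym (ind-∧ (alive x) _))))) ⟩
      ∑ V (λ x → ∑ I (λ i → ind (inClass i x) * φ i))
        ≡⟨ ∑-comm V I _ ⟩
      ∑ I (λ i → ∑ V (λ x → ind (inClass i x) * φ i))
        ≡⟨ ∑-cong I (λ {i} _ → ∑-*ʳ V (φ i) (ind ∘ inClass i)) ⟩
      ∑ I (λ i → size i * φ i) ∎
      where open ≡-Reasoning

    degree : Subset n → ℕ
    degree x = ∑ V (λ y → ind (disjoint? x y) * ind (alive y))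

    -- The remaining neighbours of x share its label, and so does x, which is not its own neighbour;
    -- the delta sum adds x as the extra element.
    degree<size : ∀ {x} → ∣ x ∣ ≡ 3 → alive x ≡ true → degree x < size (label x)
    degree<size {x} ∣x∣ ax = begin
      suc (degree x)
        ≡⟨ +-comm 1 (degree x) ⟩
      degree x + 1
        ≡⟨ cong (degree x +_) (∑-δ _≟ˢ_ {x = x} (λ _ → 1) (vertices-unique n) (∈-vertices⁺ ∣x∣)) ⟨
      degree x + ∑ V (λ y → ind (does (x ≟ˢ y)) * 1)
        ≡⟨ ∑-+ V _ _ ⟨
      ∑ V (λ y → ind (disjoint? x y) * ind (alive y) + ind (does (x ≟ˢ y)) * 1)
        ≤⟨ ∑-mono V pointwise ⟩
      size (label x) ∎
      where
      open ≤-Reasoning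
      pointwise : ∀ {y} → y ∈ V → ind (disjoint? x y) * ind (alive y) + ind (does (x ≟ˢ y)) * 1 ≤ ind (inClass (label x) y)
      pointwise {y} y∈ with x ≟ˢ y
      ... | yes refl rewrite disjoint?-irrefl {x = x} ∣x∣ | inClass-label x ax = ≤-refl
      ... | no _ with disjoint? x y in d | alive y in ay | label y Fin.≟ label x
      ... | false | _     | _      = z≤n
      ... | true  | false | _      = z≤n
      ... | true  | true  | yes _  = ≤-refl
      ... | true  | true  | no l≢l = contradiction (sym (edge⇒label≡ ∣x∣ (∈-vertices⁻ y∈) ax ay d)) l≢l

    C3-mono : ∀ {a b} → a ≤ b → a C 3 ≤ b C 3
    C3-mono a≤b with ≤⇒≤′ a≤b
    ... | ≤′-refl = ≤-refl
    ... | ≤′-step {b} a≤′b = ≤-trans (C3-mono (≤′⇒≤ a≤′b)) (subst (b C 3 ≤_) (nCk+nC[k+1]≡[n+1]C[k+1] b 2) (m≤n+m (b C 3) (b C 2)))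

    -- x meets the vertex z of another component, so x ∪ z has at most five points.
    degree+q≤d : ∀ {x} → ∣ x ∣ ≡ 3 → alive x ≡ true → degree x + q ≤ d
    degree+q≤d {x} ∣x∣ ax with another 2≤c (label x)
    ... | i , lx≢i with representative i
    ... | z , ∣z∣ , az , refl = begin
      degree x + q
        ≤⟨ +-monoʳ-≤ (degree x) (C3-mono (subst (n ∸ 5 ≤_) (sym (∣∁p∣≡n∸∣p∣ (x ∪ z))) (∸-monoʳ-≤ n ∣x∪z∣≤5))) ⟩
      degree x + ∣ ∁ (x ∪ z) ∣ C 3
        ≡⟨ cong (degree x +_) (count-disjoint (x ∪ z)) ⟨
      degree x + ∑ V (λ y → ind (disjoint? y (x ∪ z)))
        ≡⟨ ∑-+ V _ _ ⟨
      ∑ V (λ y → ind (disjoint? x y) * ind (alive y) + ind (disjoint? y (x ∪ z)))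
        ≤⟨ ∑-mono V pointwise ⟩
      ∑ V (λ y → ind (disjoint? y x))
        ≡⟨ count-disjoint x ⟩
      ∣ ∁ x ∣ C 3
        ≡⟨ cong (_C 3) (trans (∣∁p∣≡n∸∣p∣ x) (cong (n ∸_) ∣x∣)) ⟩
      d ∎
      where
      open ≤-Reasoning
      meet : 0 < ∣ x ∩ z ∣
      meet with ∣ x ∩ z ∣ in eq
      ... | suc _ = z<s
      ... | zero  = contradiction (edge⇒label≡ ∣x∣ ∣z∣ ax az (cong (_≡ᵇ 0) eq)) lx≢i
      ∣x∪z∣≤5 : ∣ x ∪ z ∣ ≤ 5
      ∣x∪z∣≤5 = +-cancelʳ-≤ 1 ∣ x ∪ z ∣ 5 (≤-trans (+-monoʳ-≤ ∣ x ∪ z ∣ meet) (≤-reflexive (trans (∣∪∣+∣∩∣ x z) (cong₂ _+_ ∣x∣ ∣z∣))))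
      pointwise : ∀ {y} → y ∈ V → ind (disjoint? x y) * ind (alive y) + ind (disjoint? y (x ∪ z)) ≤ ind (disjoint? y x)
      pointwise {y} y∈ rewrite disjoint?-∪ y x z | cong (λ t → ∣ t ∣ ≡ᵇ 0) (∩-comm x y)
        with disjoint? y x in dx | disjoint? y z in dz | alive y in ay
      ... | false | _     | _     = z≤n
      ... | true  | false | false = z≤n
      ... | true  | false | true  = ≤-refl
      ... | true  | true  | false = ≤-refl
      ... | true  | true  | true  = contradiction
            (trans (sym (edge⇒label≡ (∈-vertices⁻ y∈) ∣x∣ ay ax dx)) (edge⇒label≡ (∈-vertices⁻ y∈) ∣z∣ ay az dz)) lx≢i

    size>0 : ∀ i → 0 < size i
    size>0 i with representative i
    ... | x , ∣x∣ , ax , refl = ≤-<-trans z≤n (degree<size ∣x∣ ax)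

    size≤total : ∀ i → size i ≤ n C 3
    size≤total i = ≤-trans (∑-mono V λ {x} _ → ind≤1 (inClass i x)) (≤-reflexive (count-vertices n))
      where
      ind≤1 : ∀ b → ind b ≤ 1
      ind≤1 true  = ≤-refl
      ind≤1 false = z≤n

    excess : Fin c → ℕ
    excess i = pred (size i)

    size≡ : ∀ i → size i ≡ suc (excess i)
    size≡ i = sym (suc-pred (size i) {{>-nonZero (size>0 i)}})

    -- The total of the fractional weights: the s vertices of a component, each of weight (3 (s - 1)
    -- + n) / s, add up to one summand.
    Y : ℕ
    Y = ∑ I (λ i → 3 * excess i + n)

    -- K stands for a common multiple of the component sizes s and makes the weights K (3 (s − 1) + n) / s integral.
    module Weighted (K : ℕ) (K≢0 : NonZero K) (K/size : Fin c → ℕ) (K≡ : ∀ i → K ≡ K/size i * size i) where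

      weight : Fin c → ℕ
      weight i = K/size i * (3 * excess i + n)

      f : Subset n → ℕ
      f x = ind (alive x) * weight (label x)

      open LocalBound 6≤n f (n * K) using (local; M; weight≤; weight<)

      -- Every remaining neighbour of x lies in the component of x and has the same weight, while
      -- deleted neighbours have weight 0, so the share depends on x only through its degree and its
      -- label.
      local≡ : ∀ {x} → x ∈ V → alive x ≡ true → local x ≡ weight (label x) * (weight (label x) * (degree x + μ))
      local≡ {x} x∈ ax = begin
        ∑ V (λ y → ind (disjoint? x y) * (f x * f y)) + μ * (f x * f x)
          ≡⟨ cong₂ (λ s t → s + μ * (t * t)) (∑-cong V pointwise) fx ⟩
        ∑ V (λ y → ind (disjoint? x y) * ind (alive y) * (w * w)) + μ * (w * w)
          ≡⟨ cong (_+ μ * (w * w)) (∑-*ʳ V (w * w) _) ⟩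
        degree x * (w * w) + μ * (w * w)
          ≡⟨ arith (degree x) μ w ⟩
        w * (w * (degree x + μ)) ∎
        where
        open ≡-Reasoning
        w = weight (label x)
        fx : f x ≡ w
        fx = trans (cong (λ b → ind b * w) ax) (*-identityˡ w)
        arith : ∀ d μ w → d * (w * w) + μ * (w * w) ≡ w * (w * (d + μ))
        arith = solve-∀
        pointwise : ∀ {y} → y ∈ V → ind (disjoint? x y) * (f x * f y) ≡ ind (disjoint? x y) * ind (alive y) * (w * w)
        pointwise {y} y∈ rewrite fx with disjoint? x y in d | alive y in ay
        ... | false | _     = refl
        ... | true  | false = trans (*-identityˡ (w * 0)) (*-zeroʳ w)
        ... | true  | true  rewrite edge⇒label≡ (∈-vertices⁻ x∈) (∈-vertices⁻ y∈) ax ay d = arith₂ (weight (label y))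
          where
          arith₂ : ∀ w → 1 * (w * (1 * w)) ≡ 1 * 1 * (w * w)
          arith₂ = solve-∀

      K/size≢0 : ∀ i → NonZero (K/size i)
      K/size≢0 i = m*n≢0⇒m≢0 (K/size i) {size i} {{subst NonZero (K≡ i) K≢0}}

      weight≢0 : ∀ i → NonZero (weight i)
      weight≢0 i = m*n≢0 (K/size i) (3 * excess i + n) {{K/size≢0 i}} {{>-nonZero (≤-trans (s≤s z≤n) (≤-trans 9≤n (m≤n+m n (3 * excess i))))}}

      -- The degree bound carries a factor s on its right-hand side; multiplying by K/s makes the
      -- bound n K μ, the same for all components, which is what a single constant B requires.
      budget : ∀ i → K/size i * (n * suc (excess i) * μ) ≡ n * K * μ
      budget i = begin
        K/size i * (n * suc (excess i) * μ)    ≡⟨ arith (K/size i) n (suc (excess i)) μ ⟩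
        n * (K/size i * suc (excess i)) * μ    ≡⟨ cong (λ s → n * (K/size i * s) * μ) (size≡ i) ⟨
        n * (K/size i * size i) * μ            ≡⟨ cong (λ k → n * k * μ) (K≡ i) ⟨
        n * K * μ                              ∎
        where
        open ≡-Reasoning
        arith : ∀ k n s μ → k * (n * s * μ) ≡ n * (k * s) * μ
        arith = solve-∀

      degree≤excess : ∀ {x} → ∣ x ∣ ≡ 3 → alive x ≡ true → degree x ≤ excess (label x)
      degree≤excess {x} ∣x∣ ax = s≤s⁻¹ (subst (degree x <_) (size≡ (label x)) (degree<size ∣x∣ ax))

      weighted-f : ∀ {x} → alive x ≡ true → weight (label x) * (n * K * μ) ≡ n * K * μ * f x
      weighted-f {x} ax = trans (*-comm (weight (label x)) (n * K * μ))
        (cong (n * K * μ *_) (sym (trans (cong (λ b → ind b * weight (label x)) ax) (*-identityˡ _))))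

      local≤ : ∀ {x} → x ∈ V → local x ≤ n * K * μ * f x
      local≤ {x} x∈ = case-alive (alive x) refl
        where
        open ≤-Reasoning
        i = label x
        case-alive : ∀ b → alive x ≡ b → local x ≤ n * K * μ * f x
        case-alive false dead = ≤-trans (≤-reflexive (cong₂ _+_ (trans (∑-cong V λ {y} _ → trans (cong (λ t → ind (disjoint? x y) * (t * f y)) fx≡0) (*-zeroʳ (ind (disjoint? x y)))) (∑-0 V))
            (trans (cong (λ t → μ * (t * t)) fx≡0) (*-zeroʳ μ)))) z≤n
          where
          fx≡0 : f x ≡ 0
          fx≡0 = cong (λ b → ind b * weight i) dead
        case-alive true ax = begin
          local x                                              ≡⟨ local≡ x∈ ax ⟩
          weight i * (weight i * (degree x + μ))
            ≡⟨ cong (weight i *_) (*-assoc (K/size i) (3 * excess i + n) (degree x + μ)) ⟩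
          weight i * (K/size i * ((3 * excess i + n) * (degree x + μ)))
            ≤⟨ *-monoʳ-≤ (weight i) (*-monoʳ-≤ (K/size i) (degree-bound≤ (degree≤excess (∈-vertices⁻ x∈) ax) (degree+q≤d (∈-vertices⁻ x∈) ax))) ⟩
          weight i * (K/size i * (n * suc (excess i) * μ))     ≡⟨ cong (weight i *_) (budget i) ⟩
          weight i * (n * K * μ)                               ≡⟨ weighted-f ax ⟩
          n * K * μ * f x                                      ∎

      local< : ∀ {x} → x ∈ V → alive x ≡ true → 0 < excess (label x) → local x < n * K * μ * f x
      local< {x} x∈ ax 0<u = begin-strict
        local x                                              ≡⟨ local≡ x∈ ax ⟩
        weight i * (weight i * (degree x + μ))
          ≡⟨ cong (weight i *_) (*-assoc (K/size i) (3 * excess i + n) (degree x + μ)) ⟩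
        weight i * (K/size i * ((3 * excess i + n) * (degree x + μ)))
          <⟨ *-monoʳ-< (weight i) {{weight≢0 i}} (*-monoʳ-< (K/size i) {{K/size≢0 i}}
               (degree-bound< 0<u (degree≤excess (∈-vertices⁻ x∈) ax) (degree+q≤d (∈-vertices⁻ x∈) ax))) ⟩
        weight i * (K/size i * (n * suc (excess i) * μ))     ≡⟨ cong (weight i *_) (budget i) ⟩
        weight i * (n * K * μ)                               ≡⟨ weighted-f ax ⟩
        n * K * μ * f x                                      ∎
        where
        open ≤-Reasoning
        i = label x

      ∑f≡KY : ∑ V f ≡ K * Y
      ∑f≡KY = begin
        ∑ V f                                               ≡⟨ ∑-partition weight ⟩
        ∑ I (λ i → size i * weight i)
          ≡⟨ ∑-cong I (λ {i} _ → trans (arith (size i) (K/size i) (3 * excess i + n)) (cong (_* (3 * excess i + n)) (sym (K≡ i)))) ⟩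
        ∑ I (λ i → K * (3 * excess i + n))                  ≡⟨ ∑-*ˡ I K _ ⟩
        K * Y                                               ∎
        where
        open ≡-Reasoning
        arith : ∀ s k e → s * (k * e) ≡ k * s * e
        arith = solve-∀

      private
        MnK : M * (n * K) ≡ K * (M * n)
        MnK = trans (sym (*-assoc M n K)) (*-comm (M * n) K)

      Y≤Mn : Y ≤ M * n
      Y≤Mn = *-cancelˡ-≤ K {{K≢0}} (subst₂ _≤_ ∑f≡KY MnK (weight≤ local≤))

      Y<Mn : ∀ {i} → 0 < excess i → Y < M * n
      Y<Mn {i} 0<u with representative i
      ... | x , ∣x∣ , ax , refl = *-cancelˡ-< K Y (M * n)
        (subst₂ _<_ ∑f≡KY MnK (weight< local≤ (∈-vertices⁺ ∣x∣) (local< (∈-vertices⁺ ∣x∣) ax 0<u)))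

    private
      size∣ : ∀ i → size i ∣ (n C 3) !
      size∣ i = m∣n! (size>0 i) (size≤total i)

      -- All sizes lie between 1 and C(n,3), so the factorial of C(n,3) is a common multiple.
      module W = Weighted ((n C 3) !) ((n C 3) !≢0) (λ i → _∣_.quotient (size∣ i)) (λ i → _∣_.equality (size∣ i))

    Y≤Mn : Y ≤ ((n ∸ 1) C 2) * n
    Y≤Mn = W.Y≤Mn

    Y<Mn : ∀ {i} → 0 < excess i → Y < ((n ∸ 1) C 2) * n
    Y<Mn = W.Y<Mn

    aliveCount : ℕ
    aliveCount = ∑ V (ind ∘ alive)

    aliveCount≡ : aliveCount ≡ ∑ I size
    aliveCount≡ = begin
      aliveCount                          ≡⟨ ∑-cong V (λ _ → *-identityʳ _) ⟨
      ∑ V (λ x → ind (alive x) * 1)       ≡⟨ ∑-partition (λ _ → 1) ⟩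
      ∑ I (λ i → size i * 1)              ≡⟨ ∑-cong I (λ {i} _ → *-identityʳ (size i)) ⟩
      ∑ I size                            ∎
      where open ≡-Reasoning

    -- Each component contributes 3 (s - 1) + n to `Y`; adding 3 per component replaces s - 1 by s
    -- and avoids subtraction in ℕ.
    Y+3c≡ : Y + 3 * c ≡ 3 * aliveCount + n * c
    Y+3c≡ = begin
      Y + 3 * c                                    ≡⟨ cong (Y +_) (trans (*-comm 3 c) (sym (∑-const-Fin c 3))) ⟩
      Y + ∑ I (λ _ → 3)                            ≡⟨ ∑-+ I _ _ ⟨
      ∑ I (λ i → 3 * excess i + n + 3)
        ≡⟨ ∑-cong I (λ {i} _ → trans (arith (excess i) n) (cong (λ s → 3 * s + n) (sym (size≡ i)))) ⟩
      ∑ I (λ i → 3 * size i + n)                   ≡⟨ ∑-+ I _ _ ⟩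
      ∑ I (λ i → 3 * size i) + ∑ I (λ _ → n)       ≡⟨ cong₂ _+_ (∑-*ˡ I 3 size) (trans (∑-const-Fin c n) (*-comm c n)) ⟩
      3 * ∑ I size + n * c                         ≡⟨ cong (λ s → 3 * s + n * c) aliveCount≡ ⟨
      3 * aliveCount + n * c                       ∎
      where
      open ≡-Reasoning
      arith : ∀ e n → 3 * e + n + 3 ≡ 3 * suc e + n
      arith = solve-∀

  -- The toughness bound and its equality case.

  ∑-complement : ∀ n (S : VSet n) → ∑ (vertices n) (ind ∘ S) + ∑ (vertices n) (ind ∘ not ∘ S) ≡ n C 3
  ∑-complement n S = trans (sym (∑-+ (vertices n) _ _))
    (trans (∑-cong (vertices n) λ {x} _ → ind-not (S x)) (count-vertices n))

  module VertexCut {n} (9≤n : 9 ≤ n) (S : VSet n) (c : ℕ) (cut : IsCutWith n 3 S c) where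
    private
      M : ℕ
      M = (n ∸ 1) C 2

      comp : (x : Subset n) → Remains n 3 S x → Fin c
      comp = proj₁ (proj₁ cut)

      comp⇔ : ∀ x y (rx : Remains n 3 S x) (ry : Remains n 3 S y) → (comp x rx ≡ comp y ry) ⇔ ConnMinus n 3 S x y
      comp⇔ = proj₁ (proj₂ (proj₁ cut))

      remains? : ∀ x → Dec (Remains n 3 S x)
      remains? x = (∣ x ∣ ≟ 3) ×-dec (S x Bool.≟ false)

      label : Subset n → Fin c
      label x with remains? x
      ... | yes rx = comp x rx
      -- An arbitrary label for subsets that are not remaining vertices; it exists because c ≥ 2 is
      -- positive.
      ... | no _   = Fin.fromℕ< (≤-trans (s≤s z≤n) (proj₂ cut))

      -- `comp` also takes the proof that x remains. Two such proofs yield the same label because x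
      -- is connected to itself by the empty path.
      label≡comp : ∀ x rx → label x ≡ comp x rx
      label≡comp x rx with remains? x
      ... | yes rx′ = Equivalence.from (comp⇔ x x rx′ rx) ε
      ... | no ¬rx  = contradiction rx ¬rx

      alive⇒kept : ∀ {x} → not (S x) ≡ true → S x ≡ false
      alive⇒kept = not-injective

      edge⇒label≡ : ∀ {x y} → ∣ x ∣ ≡ 3 → ∣ y ∣ ≡ 3 → not (S x) ≡ true → not (S y) ≡ true →
                    disjoint? x y ≡ true → label x ≡ label y
      edge⇒label≡ {x} {y} ∣x∣ ∣y∣ ax ay d = begin
        label x     ≡⟨ label≡comp x rx ⟩
        comp x rx   ≡⟨ Equivalence.from (comp⇔ x y rx ry) ((rx , ry , disjoint?⇒Adj x y d) ◅ ε) ⟩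
        comp y ry   ≡⟨ label≡comp y ry ⟨
        label y     ∎
        where
        open ≡-Reasoning
        rx = ∣x∣ , alive⇒kept ax
        ry = ∣y∣ , alive⇒kept ay

      representative : ∀ i → ∃[ x ] (∣ x ∣ ≡ 3 × not (S x) ≡ true × label x ≡ i)
      representative i with proj₂ (proj₂ (proj₁ cut)) i
      ... | x , rx , comp≡i = x , proj₁ rx , cong not (proj₂ rx) , trans (label≡comp x rx) comp≡i

    open Cut 9≤n c (not ∘ S) label edge⇒label≡ representative (proj₂ cut)
      using (Y; Y≤Mn; Y<Mn; Y+3c≡; excess; size; size≡; aliveCount; aliveCount≡; degree; degree<size)

    private
      Mn≡ : M * n ≡ 3 * card n 3 S + 3 * aliveCount
      Mn≡ = begin
        M * n                                ≡⟨ *-comm M n ⟩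
        n * M                                ≡⟨ 3*C3-∸ (≤-trans (m≤m+n 3 6) 9≤n) ⟨
        3 * (n C 3)                          ≡⟨ cong (3 *_) (∑-complement n S) ⟨
        3 * (∑ (vertices n) (ind ∘ S) + aliveCount)  ≡⟨ cong (λ s → 3 * (s + aliveCount)) (card≡∑ n S) ⟨
        3 * (card n 3 S + aliveCount)        ≡⟨ *-distribˡ-+ 3 (card n 3 S) aliveCount ⟩
        3 * card n 3 S + 3 * aliveCount      ∎
        where open ≡-Reasoning

      nc≡ : n * c ≡ 3 * c + (n ∸ 3) * c
      nc≡ = trans (cong (_* c) (sym (m+[n∸m]≡n (≤-trans (m≤m+n 3 6) 9≤n)))) (*-distribʳ-+ c 3 (n ∸ 3))

      -- Combines 3 C(n,3) = M n with the splitting of all triples into deleted and remaining ones.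
      -- In this form `Y` ≤ M n and (n - 3) c ≤ 3 |S| are equivalent by cancellation, and equality
      -- in one is equality in the other.
      balance : Y + (3 * c + 3 * card n 3 S) ≡ M * n + (3 * c + (n ∸ 3) * c)
      balance = begin
        Y + (3 * c + 3 * card n 3 S)                     ≡⟨ +-assoc Y (3 * c) (3 * card n 3 S) ⟨
        Y + 3 * c + 3 * card n 3 S                       ≡⟨ cong (_+ 3 * card n 3 S) Y+3c≡ ⟩
        3 * aliveCount + n * c + 3 * card n 3 S          ≡⟨ arith (3 * aliveCount) (n * c) (3 * card n 3 S) ⟩
        3 * card n 3 S + 3 * aliveCount + n * c          ≡⟨ cong₂ _+_ (sym Mn≡) nc≡ ⟩
        M * n + (3 * c + (n ∸ 3) * c)                    ∎
        where
        open ≡-Reasoning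
        arith : ∀ a b s → a + b + s ≡ s + a + b
        arith = solve-∀

    cut-bound : (n ∸ 3) * c ≤ 3 * card n 3 S
    cut-bound = +-cancelˡ-≤ (3 * c) _ _ (+-cancelˡ-≤ (M * n) _ _ (begin
      M * n + (3 * c + (n ∸ 3) * c)   ≡⟨ balance ⟨
      Y + (3 * c + 3 * card n 3 S)    ≤⟨ +-monoˡ-≤ _ Y≤Mn ⟩
      M * n + (3 * c + 3 * card n 3 S) ∎))
      where open ≤-Reasoning

    module _ (tight : 3 * card n 3 S ≡ (n ∸ 3) * c) where
      private
        V : List (Subset n)
        V = vertices n

        Y≡Mn : Y ≡ M * n
        Y≡Mn = +-cancelʳ-≡ (3 * c + (n ∸ 3) * c) Y (M * n) (trans (cong (λ t → Y + (3 * c + t)) (sym tight)) balance)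

        excess≡0 : ∀ i → excess i ≡ 0
        excess≡0 i with excess i in eq
        ... | zero  = refl
        ... | suc _ = contradiction Y≡Mn (<⇒≢ (Y<Mn {i} (subst (0 <_) (sym eq) z<s)))

        size≡1 : ∀ i → size i ≡ 1
        size≡1 i = trans (size≡ i) (cong suc (excess≡0 i))

        -- With all components single, `Y` is n times the number of components, which is the number
        -- of remaining vertices; compare with `Y` = M n.
        M≡aliveCount : M ≡ aliveCount
        M≡aliveCount = *-cancelʳ-≡ M aliveCount n {{>-nonZero (≤-trans (s≤s z≤n) 9≤n)}} (begin
          M * n                                             ≡⟨ Y≡Mn ⟨
          ∑ (allFin c) (λ i → 3 * excess i + n)
            ≡⟨ ∑-cong (allFin c) (λ {i} _ → cong (λ u → 3 * u + n) (excess≡0 i)) ⟩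
          ∑ (allFin c) (λ _ → n)                            ≡⟨ ∑-const-Fin c n ⟩
          c * n
            ≡⟨ cong (_* n) (trans (sym (*-identityʳ c)) (sym (∑-const-Fin c 1))) ⟩
          ∑ (allFin c) (λ _ → 1) * n                        ≡⟨ cong (_* n) (∑-cong (allFin c) (λ {i} _ → size≡1 i)) ⟨
          ∑ (allFin c) size * n                             ≡⟨ cong (_* n) aliveCount≡ ⟨
          aliveCount * n                                    ∎)
          where open ≡-Reasoning

        neighbour⇒degree>0 : ∀ {x y} → ∣ y ∣ ≡ 3 → not (S y) ≡ true → disjoint? x y ≡ true → 0 < degree x
        neighbour⇒degree>0 {x} {y} ∣y∣ ay d = subst (_< degree x) (∑-0 V)
          (∑-mono-< {xs = V} {λ _ → 0} {λ y → ind (disjoint? x y) * ind (not (S y))} {y}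
            (λ _ → z≤n) (∈-vertices⁺ ∣y∣) (subst₂ (λ s t → 0 < ind s * ind t) (sym d) (sym ay) z<s))

      -- The remaining vertices form the independent set: a remaining neighbour would give x
      -- positive degree, while the degree is below the component size 1. It is maximum because it
      -- has M elements, the Erdős-Ko-Rado bound.
      tight⇒complement : ComplementOfMaxIndep n 3 S
      tight⇒complement = not ∘ S , (independent , maximum) , λ x _ → sym (not-involutive (S x))
        where
        independent : Independent n 3 (not ∘ S)
        independent x y ∣x∣ ∣y∣ ax ay _ adj = <⇒≱ (degree<size ∣x∣ ax)
          (subst (_≤ _) (sym (size≡1 (label x)))
            (neighbour⇒degree>0 {x} {y} ∣y∣ ay (cong (_≡ᵇ 0) (Adj⇒∣x∩y∣≡0 {x = x} {y} adj))))
        maximum : (J : VSet n) → Independent n 3 J → card n 3 J ≤ card n 3 (not ∘ S)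
        maximum J ind-J = begin
          card n 3 J          ≤⟨ independent≤star (≤-trans (m≤m+n 6 3) 9≤n) J ind-J ⟩
          M                   ≡⟨ M≡aliveCount ⟩
          aliveCount          ≡⟨ card≡∑ n (not ∘ S) ⟨
          card n 3 (not ∘ S)  ∎
          where open ≤-Reasoning

  -- The complement of a star attains the bound.

  index-lookup : ∀ {X : Set} {xs : List X} → Unique xs → ∀ i (p : List.lookup xs i ∈ xs) → index p ≡ i
  index-lookup {xs = x ∷ xs} (x∉ ∷ u) zero    (here _)  = refl
  index-lookup {xs = x ∷ xs} (x∉ ∷ u) zero    (there p) = contradiction p (All¬⇒¬Any x∉)
  index-lookup {xs = x ∷ xs} (x∉ ∷ u) (suc i) (here eq) = contradiction (subst (_∈ xs) eq (∈-lookup i)) (All¬⇒¬Any x∉)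
  index-lookup {xs = x ∷ xs} (x∉ ∷ u) (suc i) (there p) = cong suc (index-lookup u i p)

  -- Deleting every triple that misses point 0 leaves pairwise intersecting triples, so each one is
  -- a component by itself. It is labelled by its position in the list of remaining triples.
  module Star {k : ℕ} (8≤k : 8 ≤ k) where
    private
      n : ℕ
      n = suc k

      ∋0 : Subset n → Bool
      ∋0 x = lookup x zero

      S : VSet n
      S x = not (∋0 x)

      star : List (Subset n)
      star = filterᵇ ∋0 (vertices n)

      star-unique : Unique star
      star-unique = filter⁺ (T? ∘ ∋0) (vertices-unique n)

      remains⇒∈star : ∀ x → Remains n 3 S x → x ∈ star
      remains⇒∈star x (∣x∣ , Sx) = ∈-filter⁺ (T? ∘ ∋0) (∈-vertices⁺ ∣x∣) (subst Bool.T (sym (not-injective Sx)) _)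

      ∈star⇒remains : ∀ {x} → x ∈ star → Remains n 3 S x
      ∈star⇒remains {x} x∈ with ∈-filter⁻ (T? ∘ ∋0) {xs = vertices n} x∈
      ... | x∈V , T∋0 = ∈-vertices⁻ x∈V , cong not (Equivalence.to T-≡ T∋0)

      comp : (x : Subset n) → Remains n 3 S x → Fin (length star)
      comp x rx = index (remains⇒∈star x rx)

      no-edge : ∀ {x y} → Remains n 3 S x → Remains n 3 S y → ¬ Adj n x y
      no-edge {x} {y} (_ , Sx) (_ , Sy) adj = adj (zero , lookup⇒[]= zero (x ∩ y)
        (trans (lookup-zipWith _∧_ zero x y) (cong₂ _∧_ (not-injective Sx) (not-injective Sy))))

      connected⇒≡ : ∀ {x y} → ConnMinus n 3 S x y → x ≡ y
      connected⇒≡ ε = refl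
      connected⇒≡ ((rx , ry , adj) ◅ _) = contradiction adj (no-edge rx ry)

      -- The position is computed from a proof of remaining, so equal vertices receive equal labels
      -- only after the two proofs are identified; both components are equality proofs in sets.
      comp-cong : ∀ {x y} rx ry → x ≡ y → comp x rx ≡ comp y ry
      comp-cong {x} {.x} (p , q) (p′ , q′) refl = cong₂ (λ p q → comp x (p , q)) (≡-irrelevant p p′) (Bool-irrelevant q q′)
        where
        Bool-irrelevant : ∀ {a b : Bool} (p q : a ≡ b) → p ≡ q
        Bool-irrelevant refl refl = refl

      components : HasComponents n 3 S (length star)
      components = comp
        , (λ x y rx ry → mk⇔
            (λ eq → subst (ConnMinus n 3 S x) (index-injective (setoid _) (remains⇒∈star x rx) (remains⇒∈star y ry) eq) ε)
            (λ conn → comp-cong rx ry (connected⇒≡ conn)))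
        -- The membership proof behind `comp` is rebuilt by filtering and may differ from the one
        -- given by `i`; since the list has no repetitions, it still points to position `i`.
        , λ i → List.lookup star i , ∈star⇒remains (∈-lookup i) , index-lookup star-unique i _

      length-star : length star ≡ k C 2
      length-star = trans (length-filter ∋0 (vertices n)) (count-∋ {k} zero)

      2≤length : 2 ≤ length star
      2≤length = subst (2 ≤_) (sym length-star) (*-cancelˡ-≤ 2 (2*2≤2*kC2 8≤k))
        where
        2*2≤2*kC2 : ∀ {k} → 8 ≤ k → 4 ≤ 2 * (k C 2)
        2*2≤2*kC2 {suc k} (s≤s 7≤k) = subst (4 ≤_) (sym (2*C2 k))
          (*-mono-≤ {2} {suc k} {2} {k} (s≤s (≤-trans (s≤s z≤n) 7≤k)) (≤-trans (s≤s (s≤s z≤n)) 7≤k))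

    -- Here k = n - 1, so `k ∸ 2` is the numerator n - 3 of the toughness.
    star-attains : ∃[ S ] ∃[ c ] (IsCutWith n 3 S c × RatioEq n 3 S c (k ∸ 2) 3)
    star-attains = S , length star , (components , 2≤length) , (begin
      3 * card n 3 S              ≡⟨ cong (3 *_) (trans (card≡∑ n S) (count-∌ {k} zero)) ⟩
      3 * (k C 3)                 ≡⟨ 3*C3≡[k-2]*C2 (≤-trans (m≤m+n 2 6) 8≤k) ⟩
      (k ∸ 2) * (k C 2)           ≡⟨ cong ((k ∸ 2) *_) length-star ⟨
      (k ∸ 2) * length star       ∎)
      where open ≡-Reasoning

open import Data.Nat using (ℕ; suc; s≤s; _≤_; _∸_)
open CutBound

theorem20 : (n : ℕ) → 9 ≤ n →
    ToughnessIs n 3 (n ∸ 3) 3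
    × ((S : VSet n) (c : ℕ) → IsCutWith n 3 S c → RatioEq n 3 S c (n ∸ 3) 3 →
    ComplementOfMaxIndep n 3 S)
theorem20 (suc k) 9≤n@(s≤s 8≤k) =
  (VertexCut.cut-bound 9≤n , Star.star-attains 8≤k) , VertexCut.tight⇒complement 9≤n
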